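{- For all odd $n = 2m+1$ there exist shorthand universal tori of the permutations of $\{0,1,\ldots,n-1\}$ of size $2$-by-$\frac{n!}{2}$ with $2$-by-$m$ windows which, moreover, partition into $2^{m-1}$ matching blocks.
   Context: Shorthand universal torus: let $[n]=\{0,1,\ldots,n-1\}$ and let $S_{n-1}(n)$ be the set of $(n-1)$-permutations of $[n]$, i.e. words of length $n-1$ with pairwise distinct entries in $[n]$ (each encodes a unique permutation of $[n]$ by appending its missing symbol). Given $R\cdot C = n!$ and $r \cdot c = n-1$, an $R$-by-$C$ shorthand universal torus of the permutations of $[n]$ with $r$-by-$c$ windows is an $R$-by-$C$ toroidal grid with entries in $[n]$ (row and column indices taken modulo $R$ and $C$) such that for every word in $S_{n-1}(n)$ there is exactly one position $(i,j)$ for which the window with top-left corner $(i,j)$, consisting of the cells $(i+a, j+b)$ with $0\le a<r$, $0\le b<c$, spells this word when read in row-major order. (When $R=r=2$, with rows indexed $0$ and $1$, the window with top row $i=1$ has its second row wrap around to row $0$.) Degenerate case: for $n=1$ (that is, $m=0$) the sizes in the claim are not integers, and the claim is understood by convention as being satisfied by the trivial empty torus; the substantive content is for odd $n\ge 3$. Matching blocks: a block of length $k$ is a run of $k$ contiguous columns. Two columns match if they contain the same unordered set of values; two blocks of the same length match if their columns match pairwise (first with first, second with second, and so on). The torus partitions into $2^{m-1}$ matching blocks if its columns can be cut into $2^{m-1}$ consecutive blocks of equal length $\frac{n!}{2^m}$ such that any two of the blocks match. -}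

module Defs where

open import Data.Fin.Base using (Fin; toℕ)
open import Data.Fin.Properties using (nonZeroIndex)
import Data.List.Base as List
open import Data.List.Base using (List)
open import Data.List.Relation.Binary.BagAndSetEquality using (_∼[_]_; set)
open import Data.Nat.Base using (ℕ; _+_; _*_; _∸_; _^_; _/_; _!)
open import Data.Nat.DivMod using (_mod_)
open import Data.Nat.Properties using (m^n≢0)
open import Data.Product.Base using (_×_; _,_; ∃-syntax)
open import Data.Product using (∃!)
open import Data.Vec.Base using (Vec; cast; concat; tabulate)
open import Data.Vec.Relation.Unary.Unique.Propositional using (Unique)
open import Relation.Binary.PropositionalEquality.Core using (_≡_)

Torus : (R C n : ℕ) → Set
Torus R C n = Fin R → Fin C → Fin n

infixl 6 _⊕_

-- Cyclic shift: i ⊕ a is i + a reduced modulo N.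
_⊕_ : ∀ {N} → Fin N → ℕ → Fin N
_⊕_ {N} i a = _mod_ (toℕ i + a) N {{nonZeroIndex i}}

-- The r-by-c window with top-left corner (i , j), read in row-major order.
window : ∀ {R C n} (r c : ℕ) → Torus R C n → Fin R × Fin C → Vec (Fin n) (r * c)
window r c T (i , j) =
  concat (tabulate {n = r} λ a → tabulate {n = c} λ b → T (i ⊕ toℕ a) (j ⊕ toℕ b))

record IsShorthandUniversalTorus {n R C : ℕ} (r c : ℕ) (T : Torus R C n) : Set where
  field
    torus-size  : R * C ≡ n !
    window-size : r * c ≡ n ∸ 1
    universal   : (w : Vec (Fin n) (n ∸ 1)) → Unique w →
                  ∃! _≡_ λ p → cast window-size (window r c T p) ≡ w

column : ∀ {R C n} → Torus R C n → Fin C → List (Fin n)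
column T j = List.tabulate λ i → T i j

ColumnsMatch : ∀ {R C n} → Torus R C n → Fin C → Fin C → Set
ColumnsMatch T j k = column T j ∼[ set ] column T k

-- The blocks of length ℓ whose first columns are j and k match.
BlocksMatch : ∀ {R C n} (ℓ : ℕ) → Torus R C n → Fin C → Fin C → Set
BlocksMatch ℓ T j k = (t : Fin ℓ) → ColumnsMatch T (j ⊕ toℕ t) (k ⊕ toℕ t)

-- The torus has no distinguished first column, so the first cut s is arbitrary.
PartitionsIntoMatchingBlocks : ∀ {R C n} (count ℓ : ℕ) → Torus R C n → Set
PartitionsIntoMatchingBlocks {C = C} count ℓ T =
  count * ℓ ≡ C ×
  (∃[ s ] ((p q : Fin count) → BlocksMatch ℓ T (s ⊕ (toℕ p * ℓ)) (s ⊕ (toℕ q * ℓ))))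

infixl 7 _/2^_

_/2^_ : ℕ → ℕ → ℕ
N /2^ m = _/_ N (2 ^ m) {{m^n≢0 2 m}}

{-# OPTIONS --safe #-}

-- Up to the orientation of its columns, a window is a state: a list of m disjoint pairs, of
-- which there are L = n!/2^m.  Moving on by one column drops the first pair and appends any
-- admissible pair, so two states with the same tail have the same successors.  Rotating states
-- partitions them into cycles, and exchanging the successors of two states with equal tails
-- glues their cycles.  Gluing is impossible only when the cycle contains every state, because
-- rotations and changes of the first pair act on the word (missing symbol, state) as exchanges
-- of the first entry with any other, and these generate all permutations.
--
-- The torus runs through the resulting cyclic sequence of L columns in 2^(m-1) passes.  In pass p
-- the columns with index k modulo m are oriented by the k-th binary digit of p, for k < m - 1,
-- while those with k = m - 1 keep a fixed orientation, which makes the row readable.  As m divides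
-- L, a window meets every residue once.  A window that straddles two passes reads low digits of
-- p + 1 and high digits of p, and these still determine p.
module Submission where

open import Defs
open import Data.Nat.Base using (ℕ; _+_; _*_; _∸_; _^_; _/_; _!; _≤_)
open import Data.Product.Base using (_×_; Σ-syntax)
open import Relation.Binary.PropositionalEquality.Core using (_≡_)

open import Data.Bool.Base using (Bool; true; false; not; _xor_)
open import Data.Bool.Properties using (xor-assoc; xor-same; xor-identityʳ)
open import Data.Empty using (⊥-elim)
open import Data.Fin.Base as Fin using (Fin; toℕ; fromℕ<; combine; remQuot)
open import Data.Fin.Patterns using (0F; 1F)
import Data.Fin.Properties as Fin
open import Data.List.Base as List
  using (List; []; _∷_; _++_; _∷ʳ_; [_]; length; map; concatMap; allFin; lookup; drop; head; tabulate)
open import Data.List.Membership.Propositional using (_∈_; _∉_; find; lose)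
open import Data.List.Membership.Propositional.Properties
  using (∈-∃++; ∈-++⁻; ∈-++⁺ˡ; ∈-++⁺ʳ; ∈-map⁻; ∈-map⁺; ∈-concatMap⁺; ∈-concatMap⁻;
         ∈-lookup; ∈-allFin; ∈-tabulate⁻)
open import Data.List.Properties as List
  using (++-assoc; ++-identityʳ; ∷ʳ-injective; length-++; length-map; ≡-dec;
         ∷-injective; ∷-injectiveˡ; ∷-injectiveʳ; map-∘; map-++; map-tabulate; length-tabulate)
open import Data.List.Relation.Binary.BagAndSetEquality using (bag-=⇒; ↭⇒∼bag)
open import Data.List.Relation.Binary.Disjoint.Propositional using (Disjoint)
open import Data.List.Relation.Binary.Permutation.Propositional as Perm
  using (_↭_; refl; prep; swap; ↭-refl; ↭-sym; ↭-trans; ↭-reflexive; ↭⇒↭ₛ)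
open import Data.List.Relation.Binary.Permutation.Propositional.Properties
  using (shift; ++⁺ʳ; ++-comm; ∈-resp-↭; ↭-length; ∷↭∷ʳ; drop-∷; All-resp-↭)
import Data.List.Relation.Binary.Permutation.Setoid.Properties as ↭ₛ
open import Data.List.Relation.Binary.Subset.Propositional using (_⊆_)
open import Data.List.Relation.Unary.All as All using (All; []; _∷_)
import Data.List.Relation.Unary.All.Properties as All
open import Data.List.Relation.Unary.AllPairs as AllPairs using (AllPairs; []; _∷_)
import Data.List.Relation.Unary.AllPairs.Properties as AllPairs
open import Data.List.Relation.Unary.Any using (here; there; any?; index)
open import Data.List.Relation.Unary.Any.Properties using (lookup-index)
open import Data.List.Relation.Unary.Unique.Propositional using (Unique)
import Data.List.Relation.Unary.Unique.Propositional.Properties as Unique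
open import Data.Maybe.Base using (just)
open import Data.Maybe.Properties using (just-injective)
open import Data.Nat.Base
  using (zero; suc; pred; _<_; z≤n; s≤s; ⌊_/2⌋; _%_; NonZero; >-nonZero⁻¹)
open import Data.Nat.Divisibility using (_∣_; divides; ∣-trans; ∣⇒≤; n∣m*n; m∣m*n; %-presˡ-∣)
open import Data.Nat.DivMod
open import Data.Nat.Properties
open import Data.Nat.Tactic.RingSolver using (solve-∀)
open import Data.Product.Base as Product using (_,_; ∃-syntax; proj₁; proj₂; uncurry)
open import Data.Product using (∃!)
open import Data.Product.Properties using (,-injectiveˡ; ,-injectiveʳ) renaming (≡-dec to ×-≡-dec)
open import Data.Sum.Base using (inj₁; inj₂; [_,_]′)
open import Data.Vec.Base as Vec using (Vec)
import Data.Vec.Properties as Vec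
import Data.Vec.Relation.Unary.Unique.Propositional as VecUnique
import Data.Vec.Relation.Unary.Unique.Propositional.Properties as VecUnique
open import Function.Base using (_∘_; id)
open import Relation.Binary.Definitions using (DecidableEquality; tri<; tri≈; tri>)
open import Relation.Binary.PropositionalEquality
  using (_≢_; refl; sym; trans; cong; cong₂; subst; subst₂; setoid; module ≡-Reasoning)
open import Relation.Nullary using (¬_; Dec; yes; no; ¬?; _×-dec_)
open import Relation.Nullary.Decidable using (decidable-stable)

-- Duplicate-free lists up to permutation.

Unique-resp-↭ : {A : Set} {xs ys : List A} → xs ↭ ys → Unique xs → Unique ys
Unique-resp-↭ {A} p = ↭ₛ.Unique-resp-↭ (setoid A) (↭⇒↭ₛ p)

-- The entries of `xs` are deleted from `ys` one at a time, and distinctness lets the later ones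
-- survive. The leftover `zs` serves for length bounds and, later, for the symbol missing from a
-- window.
Unique-⊆-↭ : {A : Set} {xs ys : List A} → Unique xs → xs ⊆ ys → ∃[ zs ] xs ++ zs ↭ ys
Unique-⊆-↭ {ys = ys} [] _ = ys , ↭-refl
Unique-⊆-↭ {xs = x ∷ xs} (x∉xs ∷ u) sub with ∈-∃++ (sub (here refl))
... | as , bs , refl with Unique-⊆-↭ {ys = as ++ bs} u sub′
  where
  sub′ : xs ⊆ as ++ bs
  sub′ y∈xs with ∈-resp-↭ (shift x as bs) (sub (there y∈xs))
  ... | here refl = ⊥-elim (All.lookup x∉xs y∈xs refl)
  ... | there y∈ = y∈
... | zs , p = zs , ↭-trans (prep x p) (↭-sym (shift x as bs))

Unique-⊆-length : {A : Set} {xs ys : List A} → Unique xs → xs ⊆ ys → length xs ≤ length ys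
Unique-⊆-length {xs = xs} u sub with Unique-⊆-↭ u sub
... | zs , p = ≤-trans (m≤m+n (length xs) (length zs))
                 (≤-reflexive (trans (sym (length-++ xs)) (↭-length p)))

-- Closed paths of shift steps and rotation orbits.

data Step {A : Set} : List A → List A → Set where
  step : ∀ {a b R} → Step (a ∷ R) (R ∷ʳ b)

-- In Path s c t the list c holds the states visited after s, so a closed path lists s last.
data Path {A : Set} : List A → List (List A) → List A → Set where
  []  : ∀ {s} → Path s [] s
  _∷_ : ∀ {s t u c} → Step s t → Path t c u → Path s (t ∷ c) u

module _ {A : Set} where

  _++ᴾ_ : ∀ {s t u : List A} {c d} → Path s c t → Path t d u → Path s (c ++ d) u
  [] ++ᴾ q = q
  (e ∷ p) ++ᴾ q = e ∷ (p ++ᴾ q)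

  splitᴾ : ∀ {s t u : List A} c {d} → Path s (c ++ t ∷ d) u → Path s (c ∷ʳ t) t × Path t d u
  splitᴾ [] (e ∷ p) = (e ∷ []) , p
  splitᴾ (_ ∷ c) (e ∷ p) with splitᴾ c p
  ... | p₁ , p₂ = (e ∷ p₁) , p₂

  -- The first step forgets the head of its source, so a nonempty path may start from any other
  -- head.
  rehead : ∀ {a b R u} {t : List A} {c} → Path (a ∷ R) (t ∷ c) u → Path (b ∷ R) (t ∷ c) u
  rehead (step ∷ p) = step ∷ p

  -- Swapping the successors of two states with the same tail merges their cycles.
  merge : ∀ {a b : A} {R c d} → a ∷ R ∈ c → b ∷ R ∈ d →
          Path (a ∷ R) c (a ∷ R) → Path (b ∷ R) d (b ∷ R) → Path (a ∷ R) (d ++ c) (a ∷ R)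
  merge {c = _ ∷ _} {d = _ ∷ _} _ _ p q = rehead q ++ᴾ rehead p

  -- The closed path is cut just after an occurrence of `t` and its two parts are interchanged.
  reroot : ∀ {s t : List A} {c} → t ∈ c → Path s c s →
           ∃[ c′ ] (c′ ↭ c × Path t c′ t)
  reroot {t = t} t∈c p with ∈-∃++ t∈c
  ... | c₁ , c₂ , refl with splitᴾ c₁ p
  ... | p₁ , p₂ = c₂ ++ (c₁ ∷ʳ t) ,
                  ↭-trans (++-comm c₂ (c₁ ∷ʳ t)) (↭-reflexive (++-assoc c₁ (t ∷ []) c₂)) ,
                  p₂ ++ᴾ p₁

  -- The rotations met from Q ++ P on, the start excluded, until the last letter of Q has been moved.
  orbit : List A → List A → List (List A)
  orbit P [] = []
  orbit P (a ∷ Q) = ((Q ++ P) ∷ʳ a) ∷ orbit (P ∷ʳ a) Q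

  orbit-path : ∀ P Q → Path (Q ++ P) (orbit P Q) (P ++ Q)
  orbit-path P [] = subst (Path P []) (sym (++-identityʳ P)) []
  orbit-path P (a ∷ Q) rewrite sym (++-assoc P [ a ] Q) =
    step ∷ subst (λ s → Path s (orbit (P ∷ʳ a) Q) ((P ∷ʳ a) ++ Q))
                 (sym (++-assoc Q P [ a ])) (orbit-path (P ∷ʳ a) Q)

  -- An orbit entry is determined by how much of `Q` has been moved: `X` and then `a` have gone to
  -- the back, while `Y` still waits at the front.
  orbit-∈⁻ : ∀ P Q {z} → z ∈ orbit P Q →
             ∃[ X ] ∃[ a ] ∃[ Y ] (Q ≡ X ++ a ∷ Y × z ≡ Y ++ P ++ (X ∷ʳ a))
  orbit-∈⁻ P (a ∷ Q) (here refl) = [] , a , Q , refl , ++-assoc Q P [ a ]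
  orbit-∈⁻ P (a ∷ Q) (there z∈) with orbit-∈⁻ (P ∷ʳ a) Q z∈
  ... | X , b , Y , refl , refl = a ∷ X , b , Y , refl , cong (Y ++_) (++-assoc P [ a ] (X ∷ʳ b))

  orbit-∈⁺ : ∀ P X a Y → Y ++ P ++ (X ∷ʳ a) ∈ orbit P (X ++ a ∷ Y)
  orbit-∈⁺ P [] a Y = here (sym (++-assoc Y P [ a ]))
  orbit-∈⁺ P (x ∷ X) a Y =
    there (subst (_∈ orbit (P ∷ʳ x) (X ++ a ∷ Y)) (cong (Y ++_) (++-assoc P [ x ] (X ∷ʳ a)))
                 (orbit-∈⁺ (P ∷ʳ x) X a Y))

  RotationClosed : List (List A) → Set
  RotationClosed c = ∀ {a R} → a ∷ R ∈ c → R ∷ʳ a ∈ c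

  rotate : ∀ {c} → RotationClosed c → ∀ X {Y} → X ++ Y ∈ c → Y ++ X ∈ c
  rotate {c} rc [] {Y} h = subst (_∈ c) (sym (++-identityʳ Y)) h
  rotate {c} rc (x ∷ X) {Y} h =
    subst (_∈ c) (++-assoc Y [ x ] X)
      (rotate rc X (subst (_∈ c) (++-assoc X Y [ x ]) (rc h)))

  -- Once every letter has been moved the rotation is `v` itself, whose successor is the first entry
  -- of the orbit; before that, the successor is the next entry.
  orbit-rotationClosed : ∀ v → RotationClosed (orbit [] v)
  orbit-rotationClosed v {b} {R} z∈ with orbit-∈⁻ [] v z∈
  ... | [] , a , [] , refl , refl = here refl
  ... | x ∷ X , a , [] , refl , refl = here (cong (_∷ʳ x) (sym (++-identityʳ (X ∷ʳ a))))
  ... | X , a , y ∷ Y , refl , refl =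
    subst (_∈ orbit [] (X ++ a ∷ y ∷ Y)) (sym (++-assoc Y (X ∷ʳ a) [ y ]))
      (subst (λ w → Y ++ ((X ∷ʳ a) ∷ʳ y) ∈ orbit [] w) (++-assoc X [ a ] (y ∷ Y))
        (orbit-∈⁺ [] (X ∷ʳ a) y Y))

  -- The last entries of the rotations run through v.
  orbit-unique : ∀ P {Q} → Unique Q → Unique (orbit P Q)
  orbit-unique P [] = []
  orbit-unique P {a ∷ Q} (a∉Q ∷ u) = All.tabulate different ∷ orbit-unique (P ∷ʳ a) u
    where
    different : ∀ {z} → z ∈ orbit (P ∷ʳ a) Q → ¬ ((Q ++ P) ∷ʳ a ≡ z)
    different z∈ eq with orbit-∈⁻ (P ∷ʳ a) Q z∈
    ... | X , b , Y , refl , refl =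
      All.lookup a∉Q (∈-++⁺ʳ X (here refl))
        (proj₂ (∷ʳ-injective _ (Y ++ (P ∷ʳ a) ++ X)
          (trans eq (trans (cong (Y ++_) (sym (++-assoc (P ∷ʳ a) X [ b ])))
                           (sym (++-assoc Y ((P ∷ʳ a) ++ X) [ b ]))))))

  -- Expresses that gluing has no candidate left in `e`.
  HeadClosed : List (List A) → List (List A) → Set
  HeadClosed e c = ∀ {a b R} → a ∷ R ∈ c → b ∷ R ∈ e → b ∷ R ∈ c

-- Enlarging a cycle by gluing rotation orbits.

module _ {A : Set} (_≟_ : DecidableEquality A) (e : List (List A))
         (unique : ∀ {s} → s ∈ e → Unique s) (rotClosed : RotationClosed e) where

  open import Data.List.Membership.DecPropositional (≡-dec _≟_) using (_∈?_)

  -- Closure under rotation makes `c` a union of whole orbits, so that a new orbit is either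
  -- contained in it or disjoint from it. The field `start∈` excludes the empty closed path.
  record PartialCycle (c : List (List A)) : Set where
    field
      {start} : List A
      start∈ : start ∈ c
      path : Path start c start
      distinct : Unique c
      within : c ⊆ e
      rotationClosed : RotationClosed c

  open PartialCycle

  -- A rotation is undone by rotating further, through the rest of the word.
  rotate⁻ : ∀ {c} → RotationClosed c → ∀ (v : List A) {z} → z ∈ orbit [] v → z ∈ c → v ∈ c
  rotate⁻ {c} rc v z∈ z∈c with orbit-∈⁻ [] v z∈
  ... | X , a , Y , refl , refl =
    subst (_∈ c) (++-assoc X [ a ] Y) (rotate rc Y z∈c)

  orbit-∈ : ∀ (b : A) R → b ∷ R ∈ orbit [] (b ∷ R)
  orbit-∈ b R = rotate (orbit-rotationClosed (b ∷ R)) R (here (cong (_∷ʳ b) (sym (++-identityʳ R))))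

  orbit-⊆ : ∀ {v} → v ∈ e → orbit [] v ⊆ e
  orbit-⊆ {v} v∈e z∈ with orbit-∈⁻ [] v z∈
  ... | X , a , Y , refl , refl =
    rotate rotClosed (X ∷ʳ a) (subst (_∈ e) (sym (++-assoc X [ a ] Y)) v∈e)

  orbit-cycle : ∀ {a R} → a ∷ R ∈ e → PartialCycle (orbit [] (a ∷ R))
  orbit-cycle {a} {R} v∈e = record
    { start∈ = orbit-∈ a R
    ; path = subst (λ s → Path s (orbit [] (a ∷ R)) (a ∷ R)) (++-identityʳ (a ∷ R)) (orbit-path [] (a ∷ R))
    ; distinct = orbit-unique [] (unique v∈e)
    ; within = orbit-⊆ v∈e
    ; rotationClosed = orbit-rotationClosed (a ∷ R)
    }

  -- By `rotate⁻`, the orbit of `b ∷ R` is disjoint from `c`. After `c` is rerooted at `a ∷ R`, the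
  -- common tail `R` lets `merge` join the two cycles.
  glue : ∀ {c a b R} → PartialCycle c → a ∷ R ∈ c → b ∷ R ∈ e → b ∷ R ∉ c →
         ∃[ c′ ] (PartialCycle c′ × length c < length c′)
  glue {c} {a} {b} {R} pc u∈c v∈e v∉c with reroot u∈c (path pc)
  ... | c′ , c′↭c , p = d ++ c′ , glued , longer
    where
    d = orbit [] (b ∷ R)
    D = orbit-cycle v∈e

    rc′ : RotationClosed c′
    rc′ h = ∈-resp-↭ (↭-sym c′↭c) (rotationClosed pc (∈-resp-↭ c′↭c h))

    glued : PartialCycle (d ++ c′)
    glued = record
      { start∈ = ∈-++⁺ʳ d (∈-resp-↭ (↭-sym c′↭c) u∈c)
      ; path = merge (∈-resp-↭ (↭-sym c′↭c) u∈c) (start∈ D) p (path D)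
      ; distinct = Unique.++⁺ (distinct D) (Unique-resp-↭ (↭-sym c′↭c) (distinct pc))
          (λ (z∈d , z∈c′) → v∉c (rotate⁻ (rotationClosed pc) (b ∷ R) z∈d (∈-resp-↭ c′↭c z∈c′)))
      ; within = λ z∈ → [ within D , (λ z∈c′ → within pc (∈-resp-↭ c′↭c z∈c′)) ]′ (∈-++⁻ d z∈)
      ; rotationClosed = λ z∈ → [ (λ h → ∈-++⁺ˡ (rotationClosed D h)) , (λ h → ∈-++⁺ʳ d (rc′ h)) ]′ (∈-++⁻ d z∈)
      }

    longer : length c < length (d ++ c′)
    longer rewrite length-++ d {c′} | ↭-length c′↭c = m<n+m (length c) (s≤s z≤n)

  data Improve (c : List (List A)) : Set where
    closed : HeadClosed e c → Improve c
    longer : ∀ {c′} → PartialCycle c′ → length c < length c′ → Improve c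

  improve : ∀ {c} → PartialCycle c → Improve c
  improve {c} pc with any? (λ v → ¬? (v ∈? c) ×-dec any? (SameTail? v) c) e
    where
    SameTail : List A → List A → Set
    SameTail v u = ∃[ b ] ∃[ a ] ∃[ R ] (v ≡ b ∷ R × u ≡ a ∷ R)

    SameTail? : ∀ v u → Dec (SameTail v u)
    SameTail? [] u = no λ { (_ , _ , _ , () , _) }
    SameTail? (_ ∷ _) [] = no λ { (_ , _ , _ , _ , ()) }
    SameTail? (b ∷ R) (a ∷ R′) with ≡-dec _≟_ R R′
    ... | yes refl = yes (b , a , R , refl , refl)
    ... | no R≢R′ = no λ { (_ , _ , _ , refl , refl) → R≢R′ refl }
  ... | yes found = let v , v∈e , v∉c , hit = find found
                        u , u∈c , same = find hit in go v∈e v∉c u∈c same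
    where
    go : ∀ {u v} → v ∈ e → v ∉ c → u ∈ c → ∃[ b ] ∃[ a ] ∃[ R ] (v ≡ b ∷ R × u ≡ a ∷ R) → Improve c
    go v∈e v∉c u∈c (_ , _ , _ , refl , refl) = let _ , pc′ , l = glue pc u∈c v∈e v∉c in longer pc′ l
  ... | no none = closed λ {a} {b} {R} u∈c v∈e → decidable-stable (b ∷ R ∈? c)
        λ v∉c → none (lose v∈e (v∉c , lose u∈c (b , a , R , refl , refl)))

  -- Every gluing lengthens the cycle, and a duplicate-free cycle within `e` is at most as long as
  -- `e`. Hence `length e` is enough fuel.
  headClosedCycle : ∀ {c} → PartialCycle c → ∃[ c′ ] (PartialCycle c′ × HeadClosed e c′)
  headClosedCycle {c} pc = go (length e) pc (m≤m+n (length e) (length c))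
    where
    go : ∀ fuel {c} → PartialCycle c → length e ≤ fuel + length c → ∃[ c′ ] (PartialCycle c′ × HeadClosed e c′)
    go fuel pc bound with improve pc
    go fuel pc bound | closed hc = _ , pc , hc
    go zero pc bound | longer pc′ l = ⊥-elim (<⇒≱ l
      (≤-trans (Unique-⊆-length (distinct pc′) (within pc′)) bound))
    go (suc fuel) {c} pc bound | longer {c′} pc′ l = go fuel pc′ (≤-trans bound
      (≤-trans (≤-reflexive (sym (+-suc fuel (length c)))) (+-monoʳ-≤ fuel l)))

-- Lists of disjoint pairs: exchanges, enumeration and counting.

Unique-++⁻ˡ : ∀ {A : Set} (xs : List A) {ys} → Unique (xs ++ ys) → Unique xs
Unique-++⁻ˡ [] _ = []
Unique-++⁻ˡ (x ∷ xs) (x∉ ∷ u) = All.++⁻ˡ xs x∉ ∷ Unique-++⁻ˡ xs u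

-- (2k + 1)! / 2 ^ k, in a form that shows the factor k.
stateCount : ℕ → ℕ
stateCount zero = 1
stateCount (suc k) = suc (suc k * 2) * suc k * stateCount k

stateCount-! : ∀ k → stateCount k * 2 ^ k ≡ suc (k * 2) !
stateCount-! zero = refl
stateCount-! (suc k) = trans (lemma k (stateCount k) (2 ^ k))
  (cong (λ z → suc (suc k * 2) * (suc k * 2 * z)) (stateCount-! k))
  where
  lemma : ∀ k N T → suc (suc k * 2) * suc k * N * (2 * T) ≡ suc (suc k * 2) * (suc k * 2 * (N * T))
  lemma = solve-∀

module _ {A : Set} where

  flatten : List (A × A) → List A
  flatten [] = []
  flatten ((a , b) ∷ s) = a ∷ b ∷ flatten s

  flatten-++ : ∀ s t → flatten (s ++ t) ≡ flatten s ++ flatten t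
  flatten-++ [] t = refl
  flatten-++ ((a , b) ∷ s) t = cong (λ l → a ∷ b ∷ l) (flatten-++ s t)

  flatten-injective : ∀ s t → flatten s ≡ flatten t → s ≡ t
  flatten-injective [] [] _ = refl
  flatten-injective (_ ∷ s) (_ ∷ t) eq with ∷-injective eq
  ... | refl , eq′ with ∷-injective eq′
  ... | refl , eq″ = cong (_ ∷_) (flatten-injective s t eq″)

  length-flatten : ∀ s → length (flatten s) ≡ length s * 2
  length-flatten [] = refl
  length-flatten (_ ∷ s) = cong (λ k → suc (suc k)) (length-flatten s)

  flatten-∈ : ∀ {a b s} → (a , b) ∈ s → a ∈ flatten s
  flatten-∈ (here refl) = here refl
  flatten-∈ (there p∈s) = there (there (flatten-∈ p∈s))

  flatten-unique⁻ : ∀ s → Unique (flatten s) → Unique s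
  flatten-unique⁻ [] _ = []
  flatten-unique⁻ ((a , b) ∷ s) ((_ ∷ a∉) ∷ _ ∷ u) =
    All.tabulate (λ p∈s eq → All.lookup a∉ (flatten-∈ (subst (_∈ s) (sym eq) p∈s)) refl) ∷ flatten-unique⁻ s u

  -- The parity of the length of `ps` tells whether `y` is the first or the second entry of its
  -- pair. In both cases only that pair changes.
  replace : ∀ ps {y qs} t′ → flatten t′ ≡ ps ++ y ∷ qs → ∀ x →
            ∃[ T₁ ] ∃[ p ] ∃[ p′ ] ∃[ T₂ ]
              (t′ ≡ T₁ ++ p′ ∷ T₂ × flatten (T₁ ++ p ∷ T₂) ≡ ps ++ x ∷ qs)
  replace [] ((y , z) ∷ t′) refl x = [] , (x , z) , (y , z) , t′ , refl , refl
  replace (z ∷ []) ((z , y) ∷ t′) refl x = [] , (z , x) , (z , y) , t′ , refl , refl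
  replace (a ∷ b ∷ ps) ((c , d) ∷ t′) eq x with ∷-injective eq
  ... | refl , eq′ with ∷-injective eq′
  ... | refl , eq″ with replace ps t′ eq″ x
  ... | T₁ , p , p′ , T₂ , refl , eq‴ =
    (a , b) ∷ T₁ , p , p′ , T₂ , refl , cong (λ l → a ∷ b ∷ l) eq‴

  -- These are the star transpositions, which generate the symmetric group.
  StarClosed : (List A → Set) → Set
  StarClosed P = ∀ x ps y qs → P (x ∷ ps ++ y ∷ qs) → P (y ∷ ps ++ x ∷ qs)

  module _ {P : List A → Set} (star : StarClosed P) where

    -- Three exchanges with the front entry make one exchange of neighbours.
    star-adjacent : ∀ ps x y l → P (ps ++ x ∷ y ∷ l) → P (ps ++ y ∷ x ∷ l)
    star-adjacent [] x y l = star x [] y l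
    star-adjacent (a ∷ ps) x y l h =
      star y ps a (x ∷ l)
        (subst (λ w → P (y ∷ w)) (++-assoc ps [ a ] (x ∷ l))
          (star x (ps ∷ʳ a) y l
            (subst (λ w → P (x ∷ w)) (sym (++-assoc ps [ a ] (y ∷ l)))
              (star a ps x (y ∷ l) h))))

    -- Induction on the derivation of the permutation. The prefix `ps` collects the entries already
    -- passed, because an exchange always involves the front of the whole word.
    star-↭ : ∀ ps {l l′} → l ↭ l′ → P (ps ++ l) → P (ps ++ l′)
    star-↭ ps refl h = h
    star-↭ ps {_ ∷ l} {_ ∷ l′} (prep x r) h =
      subst P (++-assoc ps [ x ] l′)
        (star-↭ (ps ∷ʳ x) r (subst P (sym (++-assoc ps [ x ] l)) h))
    star-↭ ps {_ ∷ _ ∷ l} {_ ∷ _ ∷ l′} (swap x y r) h =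
      subst P (++-assoc ps (y ∷ x ∷ []) l′)
        (star-↭ (ps ++ y ∷ x ∷ []) r
          (subst P (sym (++-assoc ps (y ∷ x ∷ []) l)) (star-adjacent ps x y l h)))
    star-↭ ps (Perm.trans r₁ r₂) h = star-↭ ps r₂ (star-↭ ps r₁ h)

  select : List A → List (A × List A)
  select [] = []
  select (x ∷ xs) = (x , xs) ∷ map (λ (y , r) → y , x ∷ r) (select xs)

  -- Each pair of positions is taken once, in the order of the list, together with the remaining
  -- entries. On a sorted list this gives the increasing representative of every unordered pair.
  choose : List A → List ((A × A) × List A)
  choose [] = []
  choose (x ∷ xs) = map (λ (y , r) → (x , y) , r) (select xs) ++ map (λ (p , r) → p , x ∷ r) (choose xs)

  states : ℕ → List A → List (List (A × A))
  states zero xs = [ [] ]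
  states (suc k) xs = concatMap (λ (p , r) → map (p ∷_) (states k r)) (choose xs)

  select⁻ : ∀ xs {y r} → (y , r) ∈ select xs → y ∷ r ↭ xs
  select⁻ (x ∷ xs) (here refl) = refl
  select⁻ (x ∷ xs) (there h) with ∈-map⁻ _ h
  ... | _ , h′ , refl = ↭-trans (swap _ x refl) (prep x (select⁻ xs h′))

  choose⁻ : ∀ xs {a b r} → ((a , b) , r) ∈ choose xs → a ∷ b ∷ r ↭ xs
  choose⁻ (x ∷ xs) h with ∈-++⁻ (map _ (select xs)) h
  ... | inj₁ h₁ with ∈-map⁻ _ h₁
  ... | _ , h′ , refl = prep x (select⁻ xs h′)
  choose⁻ (x ∷ xs) h | inj₂ h₂ with ∈-map⁻ _ h₂
  ... | ((a , b) , r) , h′ , refl =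
    ↭-trans (prep a (swap b x refl)) (↭-trans (swap a x refl) (prep x (choose⁻ xs h′)))

  select⁺ : ∀ {xs y} → y ∈ xs → ∃[ r ] (y , r) ∈ select xs
  select⁺ (here refl) = _ , here refl
  select⁺ {x ∷ xs} (there y∈xs) with select⁺ y∈xs
  ... | r , h = x ∷ r , there (∈-map⁺ _ h)

  map-proj₁-select : ∀ xs → map proj₁ (select xs) ≡ xs
  map-proj₁-select [] = refl
  map-proj₁-select (x ∷ xs) =
    cong (x ∷_) (trans (sym (map-∘ (select xs))) (map-proj₁-select xs))

  -- Pairs starting with `x` differ in their second entries, and since `x` does not recur, no later
  -- pair starts with it.
  choose-unique : ∀ {xs} → Unique xs → Unique (map proj₁ (choose xs))
  choose-unique [] = []
  choose-unique {x ∷ xs} (x∉xs ∷ u) =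
    subst Unique (sym split) (Unique.++⁺ (Unique.map⁺ ,-injectiveʳ u) (choose-unique u) disjoint)
    where
    split : map proj₁ (choose (x ∷ xs)) ≡ map (x ,_) xs ++ map proj₁ (choose xs)
    split = trans (map-++ proj₁ (map _ (select xs)) _)
      (cong₂ _++_
        (trans (sym (map-∘ (select xs)))
          (trans (map-∘ (select xs)) (cong (map (x ,_)) (map-proj₁-select xs))))
        (sym (map-∘ (choose xs))))

    disjoint : Disjoint (map (x ,_) xs) (map proj₁ (choose xs))
    disjoint (h₁ , h₂) with ∈-map⁻ _ h₁
    ... | y , _ , refl with ∈-map⁻ proj₁ h₂
    ... | _ , h′ , refl = All.lookup x∉xs (∈-resp-↭ (choose⁻ xs h′) (here refl)) refl

  length-select : ∀ xs → length (select xs) ≡ length xs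
  length-select xs = trans (sym (length-map proj₁ (select xs))) (cong length (map-proj₁-select xs))

  length-choose-∷ : ∀ x xs → length (choose (x ∷ xs)) ≡ length xs + length (choose xs)
  length-choose-∷ x xs = trans (length-++ (map _ (select xs)))
    (cong₂ _+_ (trans (length-map _ (select xs)) (length-select xs)) (length-map _ (choose xs)))

  -- The binomial coefficient of `suc l` over two, doubled to avoid a division.
  length-choose : ∀ xs {l} → length xs ≡ suc l → length (choose xs) * 2 ≡ suc l * l
  length-choose (x ∷ []) refl = refl
  length-choose (x ∷ xs@(_ ∷ _)) {suc l} eq = begin
    length (choose (x ∷ xs)) * 2  ≡⟨ cong (_* 2) (length-choose-∷ x xs) ⟩
    (length xs + C) * 2           ≡⟨ cong (λ k → (k + C) * 2) (suc-injective eq) ⟩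
    (suc l + C) * 2               ≡⟨ *-distribʳ-+ 2 (suc l) C ⟩
    suc l * 2 + C * 2             ≡⟨ cong (suc l * 2 +_) (length-choose xs (suc-injective eq)) ⟩
    suc l * 2 + suc l * l         ≡⟨ lemma l ⟩
    suc (suc l) * suc l           ∎
    where
    open ≡-Reasoning
    C = length (choose xs)
    lemma : ∀ l → suc l * 2 + suc l * l ≡ suc (suc l) * suc l
    lemma = solve-∀

  length-choose-odd : ∀ xs k → length xs ≡ suc (suc k * 2) → length (choose xs) ≡ suc (suc k * 2) * suc k
  length-choose-odd xs k eq = *-cancelʳ-≡ (length (choose xs)) _ 2 (trans (length-choose xs eq) (lemma k))
    where
    lemma : ∀ k → suc (suc k * 2) * (suc k * 2) ≡ suc (suc k * 2) * suc k * 2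
    lemma = solve-∀

  length-concatMap : {B C : Set} (f : B → List C) {N : ℕ} (xs : List B) →
                     (∀ {x} → x ∈ xs → length (f x) ≡ N) → length (concatMap f xs) ≡ length xs * N
  length-concatMap f [] h = refl
  length-concatMap f (x ∷ xs) h =
    trans (length-++ (f x)) (cong₂ _+_ (h (here refl)) (length-concatMap f xs (h ∘ there)))

  length-states : ∀ k xs → length xs ≡ suc (k * 2) → length (states k xs) ≡ stateCount k
  length-states zero xs _ = refl
  length-states (suc k) xs eq =
    trans (length-concatMap _ (choose xs) (λ {(p , r)} h →
             trans (length-map _ (states k r))
               (length-states k r (suc-injective (suc-injective (trans (↭-length (choose⁻ xs h)) eq))))))
      (cong (_* stateCount k) (length-choose-odd xs k eq))

  -- The enumeration is grouped by first pair. These pairs are distinct, so two groups share no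
  -- state, and the rest left by `choose` is duplicate-free for the induction.
  states-unique : ∀ k {xs} → Unique xs → Unique (states k xs)
  states-unique zero u = [] ∷ []
  states-unique (suc k) {xs} u = go (choose xs) (choose-unique u)
      λ {(p , r)} h → states-unique k (AllPairs.drop⁺ 2 (Unique-resp-↭ (↭-sym (choose⁻ xs h)) u))
    where
    f : (A × A) × List A → List (List (A × A))
    f = λ (p , r) → map (p ∷_) (states k r)

    first : ∀ {s} ps → s ∈ concatMap f ps → ∃[ p ] ∃[ t ] (p ∈ map proj₁ ps × s ≡ p ∷ t)
    first ps h with find (∈-concatMap⁻ f h)
    ... | (p , r) , p∈ , h′ with ∈-map⁻ _ h′
    ... | t , _ , eq = p , t , ∈-map⁺ proj₁ p∈ , eq

    go : ∀ ps → Unique (map proj₁ ps) → (∀ {q} → q ∈ ps → Unique (states k (proj₂ q))) → Unique (concatMap f ps)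
    go [] _ _ = []
    go ((p , r) ∷ ps) (p∉ ∷ v) h =
      Unique.++⁺ (Unique.map⁺ ∷-injectiveʳ (h (here refl))) (go ps v (h ∘ there)) disjoint
      where
      disjoint : Disjoint (map (p ∷_) (states k r)) (concatMap f ps)
      disjoint (h₁ , h₂) with ∈-map⁻ _ h₁
      ... | _ , _ , refl with first ps h₂
      ... | _ , _ , p∈ , refl = All.lookup p∉ p∈ refl

-- States as lists of increasing pairs.

module _ {n : ℕ} where

  Increasing : Fin n × Fin n → Set
  Increasing (a , b) = a Fin.< b

  Sorted : List (Fin n) → Set
  Sorted = AllPairs Fin._<_

  Sorted⇒Unique : ∀ {xs} → Sorted xs → Unique xs
  Sorted⇒Unique = AllPairs.map Fin.<⇒≢

  select-sorted : ∀ {xs y r} → Sorted xs → (y , r) ∈ select xs → Sorted r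
  select-sorted {x ∷ xs} (_ ∷ s) (here refl) = s
  select-sorted {x ∷ xs} (x< ∷ s) (there h) with ∈-map⁻ _ h
  ... | _ , h′ , refl = All.tail (All-resp-↭ (↭-sym (select⁻ xs h′)) x<) ∷ select-sorted s h′

  choose-sorted : ∀ {xs a b r} → Sorted xs → ((a , b) , r) ∈ choose xs → a Fin.< b × Sorted r
  choose-sorted {x ∷ xs} (x< ∷ s) h with ∈-++⁻ (map _ (select xs)) h
  ... | inj₁ h₁ with ∈-map⁻ _ h₁
  ... | _ , h′ , refl = All.lookup x< (∈-resp-↭ (select⁻ xs h′) (here refl)) , select-sorted s h′
  choose-sorted {x ∷ xs} (x< ∷ s) h | inj₂ h₂ with ∈-map⁻ _ h₂
  ... | _ , h′ , refl with choose-sorted s h′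
  ... | a<b , s′ = a<b , All.tail (All.tail (All-resp-↭ (↭-sym (choose⁻ xs h′)) x<)) ∷ s′

  -- In a sorted list the smaller entry `a` stands before `b`, so `choose` produces the pair in this
  -- order.
  choose⁺ : ∀ {xs a b} → Sorted xs → a Fin.< b → a ∈ xs → b ∈ xs → ∃[ r ] ((a , b) , r) ∈ choose xs
  choose⁺ _ a<b (here refl) (here refl) = ⊥-elim (Fin.<-irrefl refl a<b)
  choose⁺ {x ∷ xs} _ a<b (here refl) (there b∈) with select⁺ b∈
  ... | r , h = r , ∈-++⁺ˡ (∈-map⁺ _ h)
  choose⁺ (x< ∷ _) a<b (there a∈) (here refl) = ⊥-elim (Fin.<-asym a<b (All.lookup x< a∈))
  choose⁺ {x ∷ xs} (_ ∷ s) a<b (there a∈) (there b∈) with choose⁺ s a<b a∈ b∈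
  ... | r , h = x ∷ r , ∈-++⁺ʳ (map _ (select xs)) (∈-map⁺ _ h)

  record State (k : ℕ) (xs : List (Fin n)) (s : List (Fin n × Fin n)) : Set where
    constructor state
    field
      size : length s ≡ k
      increasing : All Increasing s
      {missing} : List (Fin n)
      exhaust : flatten s ++ missing ↭ xs

  states⁻ : ∀ k {xs s} → Sorted xs → s ∈ states k xs → State k xs s
  states⁻ zero _ (here refl) = state refl [] refl
  states⁻ (suc k) {xs} sorted h with find (∈-concatMap⁻ _ {xs = choose xs} h)
  ... | ((a , b) , r) , p∈ , h′ with ∈-map⁻ _ h′
  ... | t , t∈ , refl with choose-sorted sorted p∈
  ... | a<b , sorted′ with states⁻ k sorted′ t∈
  ... | state len inc exh =
    state (cong suc len) (a<b ∷ inc) (↭-trans (prep a (prep b exh)) (choose⁻ xs p∈))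

  states⁺ : ∀ k {xs s} → Sorted xs → State k xs s → s ∈ states k xs
  states⁺ zero {s = []} _ (state refl [] _) = here refl
  states⁺ (suc k) {xs} {(a , b) ∷ s} sorted (state len (a<b ∷ inc) exh)
    with choose⁺ sorted a<b (∈-resp-↭ exh (here refl)) (∈-resp-↭ exh (there (here refl)))
  ... | r , p∈ = ∈-concatMap⁺ _ (lose p∈ (∈-map⁺ _
    (states⁺ k (proj₂ (choose-sorted sorted p∈))
      (state (suc-injective len) inc (drop-∷ (drop-∷ (↭-trans exh (↭-sym (choose⁻ xs p∈)))))))))

  norm : Fin n × Fin n → Fin n × Fin n
  norm (a , b) with a Fin.<? b
  ... | yes _ = a , b
  ... | no _ = b , a

  norm-Increasing : ∀ {p} → Increasing p → norm p ≡ p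
  norm-Increasing {a , b} a<b with a Fin.<? b
  ... | yes _ = refl
  ... | no a≮b = ⊥-elim (a≮b a<b)

  norm-increasing : ∀ {a b} → a ≢ b → Increasing (norm (a , b))
  norm-increasing {a} {b} a≢b with a Fin.<? b
  ... | yes a<b = a<b
  ... | no a≮b with Fin.<-cmp a b
  ... | tri< a<b _ _ = ⊥-elim (a≮b a<b)
  ... | tri≈ _ a≡b _ = ⊥-elim (a≢b a≡b)
  ... | tri> _ _ b<a = b<a

  flatten-norm : ∀ s → flatten (map norm s) ↭ flatten s
  flatten-norm [] = refl
  flatten-norm ((a , b) ∷ s) with a Fin.<? b
  ... | yes _ = prep a (prep b (flatten-norm s))
  ... | no _ = swap b a (flatten-norm s)

  map-norm : ∀ {s} → All Increasing s → map norm s ≡ s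
  map-norm [] = refl
  map-norm (inc ∷ incs) = cong₂ _∷_ (norm-Increasing inc) (map-norm incs)

  flatten-increasing : ∀ s → Unique (flatten s) → All Increasing (map norm s)
  flatten-increasing [] _ = []
  flatten-increasing ((a , b) ∷ s) ((a≢b ∷ _) ∷ _ ∷ u) = norm-increasing a≢b ∷ flatten-increasing s u

  flatten-State : ∀ {k xs} s {r} → length s ≡ k → Unique xs → flatten s ++ r ↭ xs → State k xs (map norm s)
  flatten-State s {r} len u exh =
    state (trans (length-map norm s) len)
          (flatten-increasing s (Unique-++⁻ˡ (flatten s) (Unique-resp-↭ (↭-sym exh) u)))
          (↭-trans (++⁺ʳ r (flatten-norm s)) exh)

  State-rotate : ∀ {k xs p R} → State k xs (p ∷ R) → State k xs (R ∷ʳ p)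
  State-rotate {p = p@(a , b)} {R} (state len (inc ∷ incs) {r} exh) =
    state (trans (↭-length (↭-sym (∷↭∷ʳ p R))) len) (All.++⁺ incs (inc ∷ []))
      (↭-trans (++⁺ʳ r (↭-trans (↭-reflexive (flatten-++ R [ p ])) (++-comm (flatten R) (a ∷ b ∷ [])))) exh)

  State-unique : ∀ {k xs s} → Unique xs → State k xs s → Unique s
  State-unique {s = s} u (state _ _ exh) = flatten-unique⁻ s (Unique-++⁻ˡ (flatten s) (Unique-resp-↭ (↭-sym exh) u))

-- Connectedness of the states and the Hamiltonian cycle.

stateCount-nonZero : ∀ k → NonZero (stateCount k)
stateCount-nonZero zero = _
stateCount-nonZero (suc k) = m*n≢0 (suc (suc k * 2) * suc k) (stateCount k) {{_}} {{stateCount-nonZero k}}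

allFin-sorted : ∀ n → Sorted (allFin n)
allFin-sorted n = AllPairs.tabulate⁺-< id

module _ (n k : ℕ) (n≡1+2k : n ≡ suc (k * 2)) where

  allStates : List (List (Fin n × Fin n))
  allStates = states k (allFin n)

  IsState : List (Fin n × Fin n) → Set
  IsState = State k (allFin n)

  ∈⇒IsState : ∀ {s} → s ∈ allStates → IsState s
  ∈⇒IsState = states⁻ k (allFin-sorted n)

  IsState⇒∈ : ∀ {s} → IsState s → s ∈ allStates
  IsState⇒∈ = states⁺ k (allFin-sorted n)

  allStates-rotationClosed : RotationClosed allStates
  allStates-rotationClosed s∈e = IsState⇒∈ (State-rotate (∈⇒IsState s∈e))

  allFin-unique : Unique (allFin n)
  allFin-unique = Sorted⇒Unique (allFin-sorted n)

  missing-one : ∀ s {r} → length s ≡ k → flatten s ++ r ↭ allFin n → ∃[ x ] x ∷ flatten s ↭ allFin n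
  missing-one s {r} len p = singleton r (+-cancelˡ-≡ (k * 2) (length r) 1 total) p
    where
    total : k * 2 + length r ≡ k * 2 + 1
    total = begin
      k * 2 + length r               ≡⟨ cong (λ l → l * 2 + length r) len ⟨
      length s * 2 + length r        ≡⟨ cong (_+ length r) (length-flatten s) ⟨
      length (flatten s) + length r  ≡⟨ length-++ (flatten s) ⟨
      length (flatten s ++ r)        ≡⟨ ↭-length p ⟩
      length (allFin n)              ≡⟨ length-tabulate id ⟩
      n                              ≡⟨ n≡1+2k ⟩
      suc (k * 2)                    ≡⟨ +-comm 1 (k * 2) ⟩
      k * 2 + 1                      ∎
      where open ≡-Reasoning

    singleton : ∀ r → length r ≡ 1 → flatten s ++ r ↭ allFin n → ∃[ x ] x ∷ flatten s ↭ allFin n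
    singleton (x ∷ []) _ q = x , ↭-trans (++-comm [ x ] (flatten s)) q

  module _ {c : List (List (Fin n × Fin n))} (rc : RotationClosed c) (hc : HeadClosed allStates c) where

    -- Rotation brings `A` to the front, head closure replaces it by `B`, and a further rotation
    -- restores the order.
    change : ∀ P₁ {A B P₂} → P₁ ++ A ∷ P₂ ∈ c → P₁ ++ B ∷ P₂ ∈ allStates → P₁ ++ B ∷ P₂ ∈ c
    change P₁ {A} {B} {P₂} h h′ =
      rotate rc (B ∷ P₂) (hc (rotate rc P₁ h) (rotate allStates-rotationClosed P₁ h′))

    -- In a word x ∷ flatten t the front entry x is the symbol missing from the state t,
    -- so exchanging it with another entry changes a single pair of the state.
    Reached : List (Fin n) → Set
    Reached l = l ↭ allFin n × (∀ x t → l ≡ x ∷ flatten t → length t ≡ k → map norm t ∈ c)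

    reached-star : StarClosed Reached
    reached-star x ps y qs (p , reach) = p′ , reach′
      where
      p′ : y ∷ ps ++ x ∷ qs ↭ allFin n
      p′ = ↭-trans (prep y (shift x ps qs))
             (↭-trans (swap y x refl)
               (↭-trans (prep x (↭-sym (shift y ps qs))) p))

      reach′ : ∀ z t → y ∷ ps ++ x ∷ qs ≡ z ∷ flatten t → length t ≡ k → map norm t ∈ c
      reach′ z t eq len with ∷-injective eq
      -- Here `replace` runs backwards: from the pairing `t` of the new word it recovers the pairing
      -- of the old one, which `reach` places in `c`.
      ... | refl , eq′ with replace ps t (sym eq′) y
      ... | T₁ , A , B , T₂ , refl , eq″ =
        subst (_∈ c) (sym (map-++ norm T₁ (B ∷ T₂)))
          (change (map norm T₁)
            (subst (_∈ c) (map-++ norm T₁ (A ∷ T₂))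
              (reach x (T₁ ++ A ∷ T₂) (cong (x ∷_) (sym eq″))
                (trans (length-++ T₁) (trans (sym (length-++ T₁)) len))))
            (subst (_∈ allStates) (map-++ norm T₁ (B ∷ T₂))
              (IsState⇒∈ (flatten-State (T₁ ++ B ∷ T₂) len allFin-unique
                (↭-trans (++-comm (flatten (T₁ ++ B ∷ T₂)) [ z ])
                  (subst (λ l → z ∷ l ↭ allFin n) eq′ p′))))))

    -- With its missing symbol in front, each of the two states becomes a permutation of the
    -- alphabet. Star exchanges lead from one to the other and preserve `Reached`.
    connected : ∀ {s₀} → s₀ ∈ c → s₀ ∈ allStates → allStates ⊆ c
    connected {s₀} s₀∈c s₀∈e {s} s∈e =
      subst (_∈ c) (map-norm (State.increasing S))
        (proj₂ (star-↭ {P = Reached} reached-star [] (↭-trans p₀ (↭-sym p)) (p₀ , reached₀)) x s refl (State.size S))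
      where
      S₀ = ∈⇒IsState s₀∈e
      S = ∈⇒IsState s∈e
      x₀ = proj₁ (missing-one s₀ (State.size S₀) (State.exhaust S₀))
      p₀ = proj₂ (missing-one s₀ (State.size S₀) (State.exhaust S₀))
      x = proj₁ (missing-one s (State.size S) (State.exhaust S))
      p = proj₂ (missing-one s (State.size S) (State.exhaust S))

      reached₀ : ∀ y t → x₀ ∷ flatten s₀ ≡ y ∷ flatten t → length t ≡ k → map norm t ∈ c
      reached₀ y t eq _ rewrite sym (flatten-injective s₀ t (proj₂ (∷-injective eq))) =
        subst (_∈ c) (sym (map-norm (State.increasing S₀))) s₀∈c

record HamiltonCycle {A : Set} (e : List (List A)) : Set where
  field
    cycle : List (List A)
    {start} : List A
    path : Path start cycle start
    distinct : Unique cycle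
    sound : cycle ⊆ e
    complete : e ⊆ cycle

-- A state exists because their number is positive. Its rotation orbit is enlarged until it is head
-- closed, and then connectedness makes it exhaust the states.
hamilton : ∀ {n k} → n ≡ suc (suc k * 2) → HamiltonCycle (states (suc k) (allFin n))
hamilton {n} {k} n≡ = go (start-state (states (suc k) (allFin n)) nonempty id)
  where
  open PartialCycle
  E = allStates n (suc k) n≡

  nonempty : 0 < length E
  nonempty = subst (0 <_) (sym (length-states (suc k) (allFin n) (trans (length-tabulate id) n≡)))
    (>-nonZero⁻¹ _ {{stateCount-nonZero (suc k)}})

  start-state : ∀ es → 0 < length es → es ⊆ E → ∃[ s ] s ∈ E
  start-state (s ∷ _) _ h = s , h (here refl)

  go : ∃[ s ] s ∈ E → HamiltonCycle E
  go ([] , s∈) with () ← State.size (∈⇒IsState n (suc k) n≡ s∈)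
  go (a ∷ R , s∈) = record
    { cycle = proj₁ res
    ; path = path pc
    ; distinct = distinct pc
    ; sound = within pc
    ; complete = connected n (suc k) n≡ (rotationClosed pc) (proj₂ (proj₂ res)) (start∈ pc) (within pc (start∈ pc))
    }
    where
    uniq : ∀ {s} → s ∈ E → Unique s
    uniq s∈ = State-unique (allFin-unique n (suc k) n≡) (∈⇒IsState n (suc k) n≡ s∈)
    res = headClosedCycle (×-≡-dec Fin._≟_ Fin._≟_) E uniq (allStates-rotationClosed n (suc k) n≡)
            (orbit-cycle (×-≡-dec Fin._≟_ Fin._≟_) E uniq (allStates-rotationClosed n (suc k) n≡) s∈)
    pc = proj₁ (proj₂ res)

-- Binary digits and carries.

odd : ℕ → Bool
odd zero = false
odd (suc p) = not (odd p)

bit : ℕ → ℕ → Bool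
bit zero p = odd p
bit (suc k) p = bit k ⌊ p /2⌋

digit : Bool → ℕ
digit false = 0
digit true = 1

infixr 5 _∷₂_

_∷₂_ : Bool → ℕ → ℕ
b ∷₂ q = digit b + q * 2

∷₂-view : ∀ p → ∃[ b ] ∃[ q ] p ≡ b ∷₂ q
∷₂-view 0 = false , 0 , refl
∷₂-view 1 = true , 0 , refl
∷₂-view (suc (suc p)) with ∷₂-view p
... | false , q , refl = false , suc q , refl
... | true , q , refl = true , suc q , refl

odd-+*2 : ∀ p x → odd (p + x * 2) ≡ odd p
odd-+*2 p zero = cong odd (+-identityʳ p)
odd-+*2 p (suc x) rewrite +-suc p (suc (x * 2)) | +-suc p (x * 2) | odd-+*2 p x with odd p
... | false = refl
... | true = refl

half-+*2 : ∀ p x → ⌊ p + x * 2 /2⌋ ≡ ⌊ p /2⌋ + x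
half-+*2 p zero = trans (cong ⌊_/2⌋ (+-identityʳ p)) (sym (+-identityʳ _))
half-+*2 p (suc x) rewrite +-suc p (suc (x * 2)) | +-suc p (x * 2) | half-+*2 p x = sym (+-suc ⌊ p /2⌋ x)

-- Halving removes one digit of `p` and one factor two of the period. This lets the last pass of the
-- torus be followed by the first.
bit-periodic : ∀ M k → k < M → ∀ p q → bit k (p + q * 2 ^ M) ≡ bit k p
bit-periodic (suc M) k k<M p q rewrite
  trans (cong (q *_) (*-comm 2 (2 ^ M))) (sym (*-assoc q (2 ^ M) 2)) = go k k<M
  where
  go : ∀ k → k < suc M → bit k (p + q * 2 ^ M * 2) ≡ bit k p
  go zero _ = odd-+*2 p (q * 2 ^ M)
  go (suc k) (s≤s k<M) =
    trans (cong (bit k) (half-+*2 p (q * 2 ^ M))) (bit-periodic M k k<M ⌊ p /2⌋ q)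

-- In a window that runs from pass p into pass p + 1, exactly the columns with residue
-- below some θ belong to pass p + 1, so the column with residue k is in pass p + carry θ k.
carry : ℕ → ℕ → ℕ
carry zero _ = 0
carry (suc θ) zero = 1
carry (suc θ) (suc k) = carry θ k

carry-< : ∀ {θ k} → k < θ → carry θ k ≡ 1
carry-< {suc θ} {zero} _ = refl
carry-< {suc θ} {suc k} (s≤s k<θ) = carry-< k<θ

carry-≥ : ∀ {θ k} → θ ≤ k → carry θ k ≡ 0
carry-≥ {zero} _ = refl
carry-≥ {suc θ} {suc k} (s≤s θ≤k) = carry-≥ θ≤k

-- The condition that a window imposes on its pass `p`: digits below `θ` are read from `p + 1`, the
-- others from `p`.
record Counts (M θ : ℕ) (β : ℕ → Bool) (p : ℕ) : Set where
  constructor counts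
  field
    bounded : p < 2 ^ M
    bits : ∀ {k} → k < M → bit k (p + carry θ k) ≡ β k

open Counts public

carry-in : ℕ → Bool
carry-in zero = false
carry-in (suc _) = true

-- The threshold that remains after the lowest digit is removed. If that digit is 0, then `p` and
-- `p + 1` agree in all higher digits; if it is 1, the carry passes on and the threshold moves down
-- with the positions.
carry-out : Bool → ℕ → ℕ
carry-out false θ = 0
carry-out true θ = pred θ

bit-zero-∷₂ : ∀ b q θ → bit 0 ((b ∷₂ q) + carry θ 0) ≡ b xor carry-in θ
bit-zero-∷₂ b q θ rewrite +-assoc (digit b) (q * 2) (carry θ 0) | +-comm (q * 2) (carry θ 0)
  | sym (+-assoc (digit b) (carry θ 0) (q * 2)) | odd-+*2 (digit b + carry θ 0) q with b | θ
... | false | zero = refl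
... | false | suc _ = refl
... | true | zero = refl
... | true | suc _ = refl

-- After halving, a carry into `q` survives exactly when the lowest digit and the added carry are
-- both 1.
bit-suc-∷₂ : ∀ b q θ k → bit (suc k) ((b ∷₂ q) + carry θ (suc k)) ≡ bit k (q + carry (carry-out b θ) k)
bit-suc-∷₂ b q θ k rewrite +-assoc (digit b) (q * 2) (carry θ (suc k)) | +-comm (q * 2) (carry θ (suc k))
  | sym (+-assoc (digit b) (carry θ (suc k)) (q * 2)) | half-+*2 (digit b + carry θ (suc k)) q
  | +-comm ⌊ digit b + carry θ (suc k) /2⌋ q = cong (λ c → bit k (q + c)) (halved b θ)
  where
  carry≤1 : ∀ θ k → carry θ k ≤ 1
  carry≤1 zero k = z≤n
  carry≤1 (suc θ) zero = ≤-refl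
  carry≤1 (suc θ) (suc k) = carry≤1 θ k

  half≤1 : ∀ {c} → c ≤ 1 → ⌊ c /2⌋ ≡ 0
  half≤1 z≤n = refl
  half≤1 (s≤s z≤n) = refl

  half-suc≤1 : ∀ {c} → c ≤ 1 → ⌊ suc c /2⌋ ≡ c
  half-suc≤1 z≤n = refl
  half-suc≤1 (s≤s z≤n) = refl

  halved : ∀ b θ → ⌊ digit b + carry θ (suc k) /2⌋ ≡ carry (carry-out b θ) k
  halved false θ = half≤1 (carry≤1 θ (suc k))
  halved true zero = refl
  halved true (suc θ) = half-suc≤1 (carry≤1 θ k)

∷₂-bounded⁺ : ∀ b q {N} → q < N → b ∷₂ q < 2 * N
∷₂-bounded⁺ b q {N} q<N = begin-strict
  digit b + q * 2  <⟨ +-monoˡ-< (q * 2) (digit<2 b) ⟩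
  suc q * 2        ≤⟨ *-monoˡ-≤ 2 q<N ⟩
  N * 2            ≡⟨ *-comm N 2 ⟩
  2 * N            ∎
  where
  open ≤-Reasoning
  digit<2 : ∀ b → digit b < 2
  digit<2 false = s≤s z≤n
  digit<2 true = ≤-refl

∷₂-bounded⁻ : ∀ b q {N} → b ∷₂ q < 2 * N → q < N
∷₂-bounded⁻ b q {N} h =
  *-cancelʳ-< 2 q N (≤-<-trans (m≤n+m (q * 2) (digit b)) (subst (b ∷₂ q <_) (*-comm 2 N) h))

counts-∷₂⁺ : ∀ {M θ β b q} → b xor carry-in θ ≡ β 0 → Counts M (carry-out b θ) (λ k → β (suc k)) q →
             Counts (suc M) θ β (b ∷₂ q)
counts-∷₂⁺ {θ = θ} {b = b} {q} h₀ (counts bd bs) = counts (∷₂-bounded⁺ b q bd)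
  λ { {zero} _ → trans (bit-zero-∷₂ b q θ) h₀ ; {suc k} (s≤s k<M) → trans (bit-suc-∷₂ b q θ k) (bs k<M) }

counts-∷₂⁻ : ∀ {M θ β} b q → Counts (suc M) θ β (b ∷₂ q) →
             b xor carry-in θ ≡ β 0 × Counts M (carry-out b θ) (λ k → β (suc k)) q
counts-∷₂⁻ {θ = θ} b q (counts bd bs) =
  trans (sym (bit-zero-∷₂ b q θ)) (bs (s≤s z≤n)) ,
  counts (∷₂-bounded⁻ b q bd) (λ {k} k<M → trans (sym (bit-suc-∷₂ b q θ k)) (bs (s≤s k<M)))

xor-cancelʳ : ∀ x y → (x xor y) xor y ≡ x
xor-cancelʳ x y = trans (xor-assoc x y y) (trans (cong (x xor_) (xor-same y)) (xor-identityʳ x))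

xor-cancelˡ : ∀ x y → x xor (x xor y) ≡ y
xor-cancelˡ x y = trans (sym (xor-assoc x x y)) (cong (_xor y) (xor-same x))

xor-injectiveʳ : ∀ {x y} z → x xor z ≡ y xor z → x ≡ y
xor-injectiveʳ {x} {y} z eq = trans (sym (xor-cancelʳ x z)) (trans (cong (_xor z) eq) (xor-cancelʳ y z))

-- Digits are found from the lowest upwards: `β 0` and `carry-in` force the lowest one, and this
-- digit fixes the threshold for the others.
counts-exists : ∀ M θ β → ∃[ p ] Counts M θ β p
counts-exists zero θ β = 0 , counts (s≤s z≤n) λ ()
counts-exists (suc M) θ β with counts-exists M (carry-out (β 0 xor carry-in θ) θ) (λ k → β (suc k))
... | q , h = _ , counts-∷₂⁺ {b = β 0 xor carry-in θ} (xor-cancelʳ (β 0) (carry-in θ)) h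

-- Both numbers have the forced lowest digit, hence the same threshold for the remaining ones.
counts-unique : ∀ M {θ β p q} → Counts M θ β p → Counts M θ β q → p ≡ q
counts-unique zero (counts (s≤s z≤n) _) (counts (s≤s z≤n) _) = refl
counts-unique (suc M) {θ} {β} {p} {q} hp hq with ∷₂-view p | ∷₂-view q
... | b , p′ , refl | c , q′ , refl with counts-∷₂⁻ b p′ hp | counts-∷₂⁻ c q′ hq
... | hb , hp′ | hc , hq′ with xor-injectiveʳ {b} {c} (carry-in θ) (trans hb (sym hc))
... | refl = cong (b ∷₂_) (counts-unique M hp′ hq′)

-- Since `m` divides `L`, the columns past the boundary `L` start again at residue 0 and occupy just
-- the residues below `(t + m) ∸ L`.
quotient-carry : ∀ {t b m L} .{{_ : NonZero m}} .{{_ : NonZero L}} → m ∣ L → t < L → b < m →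
                 (t + b) / L ≡ carry ((t + m) ∸ L) ((t + b) % m)
quotient-carry {t} {b} {m} {L} m∣L@(divides ℓ refl) t<L b<m with (t + b) <? L
... | yes t+b<L = trans (m<n⇒m/n≡0 t+b<L) (sym (carry-≥ (m≤n+o⇒m∸n≤o (t + m) L bound)))
  where
  open ≤-Reasoning
  -- As `m` divides `L`, the first multiple of `m` above `t + b` is still at most `L`.
  bound : t + m ≤ L + (t + b) % m
  bound = begin
    t + m                                    ≤⟨ +-monoˡ-≤ m (m≤m+n t b) ⟩
    t + b + m                                ≡⟨ cong (_+ m) (m≡m%n+[m/n]*n (t + b) m) ⟩
    (t + b) % m + (t + b) / m * m + m        ≡⟨ +-assoc ((t + b) % m) _ m ⟩
    (t + b) % m + ((t + b) / m * m + m)      ≡⟨ cong ((t + b) % m +_) (+-comm _ m) ⟩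
    (t + b) % m + suc ((t + b) / m) * m      ≤⟨ +-monoʳ-≤ ((t + b) % m) (*-monoˡ-≤ m (m<n*o⇒m/o<n {n = ℓ} {o = m} t+b<L)) ⟩
    (t + b) % m + L                          ≡⟨ +-comm _ L ⟩
    L + (t + b) % m                          ∎
... | no t+b≮L = begin
  (t + b) / L                          ≡⟨ m/n≡1+[m∸n]/n L≤ ⟩
  suc ((t + b ∸ L) / L)                ≡⟨ cong suc (m<n⇒m/n≡0 (<-≤-trans r<m (∣⇒≤ m∣L))) ⟩
  1                                    ≡⟨ carry-< r<θ ⟨
  carry (t + m ∸ L) (t + b ∸ L)        ≡⟨ cong (carry (t + m ∸ L)) r≡ ⟨
  carry (t + m ∸ L) ((t + b) % m)      ∎
  where
  open ≡-Reasoning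
  L≤ : L ≤ t + b
  L≤ = ≮⇒≥ t+b≮L
  r<θ : t + b ∸ L < t + m ∸ L
  r<θ = ∸-monoˡ-< (+-monoʳ-< t b<m) L≤
  r<m : t + b ∸ L < m
  r<m = m<n+o⇒m∸n<o (t + b) L (+-mono-< t<L b<m)
  r≡ : (t + b) % m ≡ t + b ∸ L
  r≡ = trans (sym (m*n≤o⇒[o∸m*n]%n≡o%n ℓ L≤)) (m<n⇒m%n≡m r<m)

-- From the cycle to a periodic sequence of columns.

lookup-unique-injective : ∀ {A : Set} {xs : List A} → Unique xs → ∀ {i j} → lookup xs i ≡ lookup xs j → i ≡ j
lookup-unique-injective (_ ∷ _) {Fin.zero} {Fin.zero} _ = refl
lookup-unique-injective {xs = _ ∷ xs} (x∉ ∷ _) {Fin.zero} {Fin.suc j} eq = ⊥-elim (All.lookup x∉ (∈-lookup j) eq)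
lookup-unique-injective {xs = _ ∷ xs} (x∉ ∷ _) {Fin.suc i} {Fin.zero} eq = ⊥-elim (All.lookup x∉ (∈-lookup i) (sym eq))
lookup-unique-injective (_ ∷ u) {Fin.suc i} {Fin.suc j} eq = cong Fin.suc (lookup-unique-injective u eq)

module _ {A : Set} where

  path-first : ∀ {s u : List A} {c} → Path s c u → ∀ i → toℕ i ≡ 0 → Step s (lookup c i)
  path-first (e ∷ _) Fin.zero _ = e

  path-step : ∀ {s u : List A} {c} → Path s c u → ∀ i j → toℕ j ≡ suc (toℕ i) → Step (lookup c i) (lookup c j)
  path-step (_ ∷ p) Fin.zero (Fin.suc j) eq = path-first p j (suc-injective eq)
  path-step (_ ∷ p) (Fin.suc i) (Fin.suc j) eq = path-step p i j (suc-injective eq)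

  path-last : ∀ {s u : List A} {c} → Path s c u → ∀ i → suc (toℕ i) ≡ length c → lookup c i ≡ u
  path-last (_ ∷ []) Fin.zero _ = refl
  path-last (_ ∷ p@(_ ∷ _)) (Fin.suc i) eq = path-last p i (suc-injective eq)

  first : ∀ {s t : List A} → Step s t → A
  first (step {a}) = a

  head-first : ∀ {s t : List A} (e : Step s t) → head s ≡ just (first e)
  head-first step = refl

  head-drop-∷ʳ : ∀ R (b : A) i → i < length R → head (drop i (R ∷ʳ b)) ≡ head (drop i R)
  head-drop-∷ʳ (_ ∷ R) b zero _ = refl
  head-drop-∷ʳ (_ ∷ R) b (suc i) (s≤s i<) = head-drop-∷ʳ R b i i<

  head-drop-step : ∀ {s t : List A} → Step s t → ∀ i → suc i < length s → head (drop (suc i) s) ≡ head (drop i t)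
  head-drop-step (step {b = b} {R = R}) i (s≤s i<) = sym (head-drop-∷ʳ R b i i<)

  head-drop-ext : ∀ (s : List A) (f : ℕ → A) → (∀ i → i < length s → head (drop i s) ≡ just (f i)) →
                  s ≡ tabulate {n = length s} (f ∘ toℕ)
  head-drop-ext [] f h = refl
  head-drop-ext (x ∷ s) f h =
    cong₂ _∷_ (just-injective (h 0 (s≤s z≤n))) (head-drop-ext s (f ∘ suc) (λ i i< → h (suc i) (s≤s i<)))

  module Sequence (s : ℕ → List A) (steps : ∀ t → Step (s t) (s (suc t)))
                  {m : ℕ} (size : ∀ t → length (s t) ≡ m) where

    entry : ℕ → A
    entry t = first (steps t)

    entry-cong : ∀ {t u} → s t ≡ s u → entry t ≡ entry u
    entry-cong {t} {u} eq =
      just-injective (trans (sym (head-first (steps t))) (trans (cong head eq) (head-first (steps u))))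

    -- A step moves every surviving pair one place forward, so the pair at place `i` is the one
    -- dropped `i` steps later.
    entry-drop : ∀ i t → i < m → head (drop i (s t)) ≡ just (entry (t + i))
    entry-drop zero t _ = trans (head-first (steps t)) (cong (just ∘ entry) (sym (+-identityʳ t)))
    entry-drop (suc i) t i<m = begin
      head (drop (suc i) (s t))   ≡⟨ head-drop-step (steps t) i (subst (suc i <_) (sym (size t)) i<m) ⟩
      head (drop i (s (suc t)))   ≡⟨ entry-drop i (suc t) (<-trans (n<1+n i) i<m) ⟩
      just (entry (suc t + i))    ≡⟨ cong (just ∘ entry) (+-suc t i) ⟨
      just (entry (t + suc i))    ∎
      where open ≡-Reasoning

    entries : ∀ t → s t ≡ tabulate {n = m} (λ b → entry (t + toℕ b))
    entries t rewrite sym (size t) = head-drop-ext (s t) (λ i → entry (t + i))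
      (λ i i< → entry-drop i t (subst (i <_) (size t) i<))

module Periodic {A : Set} {e : List (List A)} (H : HamiltonCycle e) .{{nz : NonZero (length (HamiltonCycle.cycle H))}} where

  open HamiltonCycle H

  L : ℕ
  L = length cycle

  s : ℕ → List A
  s t = lookup cycle (t mod L)

  toℕ-mod : ∀ t → toℕ (t mod L) ≡ t % L
  toℕ-mod t = Fin.toℕ-fromℕ< (m%n<n t L)

  suc-% : ∀ t → suc t % L ≡ suc (t % L) % L
  suc-% t = trans (cong (λ x → suc x % L) (m≡m%n+[m/n]*n t L)) ([m+kn]%n≡m%n (suc (t % L)) (t / L) L)

  steps : ∀ t → Step (s t) (s (suc t))
  steps t with suc (t % L) <? L
  ... | yes r<L = path-step path (t mod L) (suc t mod L) (begin
    toℕ (suc t mod L)              ≡⟨ toℕ-mod (suc t) ⟩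
    suc t % L                      ≡⟨ suc-% t ⟩
    suc (t % L) % L                ≡⟨ m<n⇒m%n≡m r<L ⟩
    suc (t % L)                    ≡⟨ cong suc (toℕ-mod t) ⟨
    suc (toℕ (t mod L))            ∎)
    where open ≡-Reasoning
  -- The last listed state is the start of the closed path, which is also the source of its first
  -- step.
  ... | no r≮L =
    subst (λ x → Step x (s (suc t)))
      (sym (path-last path (t mod L) (trans (cong suc (toℕ-mod t)) r≡)))
      (path-first path (suc t mod L)
        (trans (toℕ-mod (suc t)) (trans (suc-% t) (trans (cong (_% L) r≡) (n%n≡0 L)))))
    where
    r≡ : suc (t % L) ≡ L
    r≡ = ≤-antisym (m%n<n t L) (≮⇒≥ r≮L)

  s∈ : ∀ t → s t ∈ e
  s∈ t = sound (∈-lookup (t mod L))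

  s-cong : ∀ {t u} → t % L ≡ u % L → s t ≡ s u
  s-cong {t} {u} eq = cong (lookup cycle) (Fin.toℕ-injective (trans (toℕ-mod t) (trans eq (sym (toℕ-mod u)))))

  s-injective : ∀ {t u} → s t ≡ s u → t % L ≡ u % L
  s-injective {t} {u} eq =
    trans (sym (toℕ-mod t)) (trans (cong toℕ (lookup-unique-injective distinct eq)) (toℕ-mod u))

  s-surjective : ∀ {z} → z ∈ e → ∃[ t ] (t < L × s t ≡ z)
  s-surjective z∈e = toℕ i , Fin.toℕ<n i ,
    trans (cong (lookup cycle) (Fin.toℕ-injective (trans (toℕ-mod (toℕ i)) (m<n⇒m%n≡m (Fin.toℕ<n i)))))
          (sym (lookup-index z∈c))
    where
    z∈c = complete z∈e
    i = index z∈c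

-- Orientations of columns.

orient : ∀ {A : Set} → Bool → A × A → A × A
orient false p = p
orient true p = Product.swap p

module _ {n : ℕ} where

  norm-orient : ∀ σ {p : Fin n × Fin n} → Increasing p → norm (orient σ p) ≡ p
  norm-orient false inc = norm-Increasing inc
  norm-orient true {a , b} a<b with b Fin.<? a
  ... | yes b<a = ⊥-elim (Fin.<-asym a<b b<a)
  ... | no _ = refl

  orient-norm : ∀ (p : Fin n × Fin n) → ∃[ σ ] orient σ (norm p) ≡ p
  orient-norm (a , b) with a Fin.<? b
  ... | yes _ = false , refl
  ... | no _ = true , refl

  -- The two entries of an increasing pair differ, so its orientation is visible.
  orient-injective : ∀ {σ τ} {p : Fin n × Fin n} → Increasing p → orient σ p ≡ orient τ p → σ ≡ τ
  orient-injective {false} {false} _ _ = refl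
  orient-injective {false} {true} a<b eq = ⊥-elim (Fin.<⇒≢ a<b (,-injectiveˡ eq))
  orient-injective {true} {false} a<b eq = ⊥-elim (Fin.<⇒≢ a<b (,-injectiveʳ eq))
  orient-injective {true} {true} _ _ = refl

  -- Compares reading a window by columns with reading it by rows, so that distinctness passes from
  -- one to the other.
  flatten-↭ : ∀ (s : List (Fin n × Fin n)) → flatten s ↭ map proj₁ s ++ map proj₂ s
  flatten-↭ [] = refl
  flatten-↭ ((a , b) ∷ s) =
    prep a (↭-trans (prep b (flatten-↭ s)) (↭-sym (shift b (map proj₁ s) (map proj₂ s))))

-- Indexing of windows and modular arithmetic.

+-swapʳ : ∀ a b c → a + b + c ≡ a + c + b
+-swapʳ = solve-∀

[m+n%d]%d≡[m+n]%d : ∀ m n d .{{_ : NonZero d}} → (m + n % d) % d ≡ (m + n) % d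
[m+n%d]%d≡[m+n]%d m n d = trans (%-distribˡ-+ m (n % d) d)
  (trans (cong (λ z → (m % d + z) % d) (m%n%n≡m%n n d)) (sym (%-distribˡ-+ m n d)))

tabulate-injective : ∀ {A : Set} {m} {f g : Fin m → A} → List.tabulate f ≡ List.tabulate g → ∀ i → f i ≡ g i
tabulate-injective eq Fin.zero = ∷-injectiveˡ eq
tabulate-injective eq (Fin.suc i) = tabulate-injective (∷-injectiveʳ eq) i

lookup-ext : ∀ {A : Set} {k} {xs ys : Vec A k} → (∀ i → Vec.lookup xs i ≡ Vec.lookup ys i) → xs ≡ ys
lookup-ext {xs = xs} {ys} h =
  trans (sym (Vec.tabulate∘lookup xs)) (trans (Vec.tabulate-cong h) (Vec.tabulate∘lookup ys))

combine-ext : ∀ {A : Set} r {c} {xs ys : Vec A (r * c)} →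
              (∀ a b → Vec.lookup xs (combine {r} a b) ≡ Vec.lookup ys (combine a b)) → xs ≡ ys
combine-ext r {c} {xs} {ys} h = lookup-ext λ i →
  subst (λ i → Vec.lookup xs i ≡ Vec.lookup ys i) (Fin.combine-remQuot {r} c i)
    (uncurry h (remQuot {r} c i))

lookup-window : ∀ {R C n} r c (T : Torus R C n) p a b →
                Vec.lookup (window r c T p) (combine a b) ≡ T (proj₁ p ⊕ toℕ a) (proj₂ p ⊕ toℕ b)
lookup-window r c T (i , j) a b = begin
  Vec.lookup (Vec.concat rows) (combine a b)   ≡⟨ Vec.lookup-concat rows a b ⟩
  Vec.lookup (Vec.lookup rows a) b             ≡⟨ cong (λ row → Vec.lookup row b) (Vec.lookup∘tabulate _ a) ⟩
  Vec.lookup (Vec.tabulate {n = c} λ b′ → T (i ⊕ toℕ a) (j ⊕ toℕ b′)) b  ≡⟨ Vec.lookup∘tabulate _ b ⟩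
  T (i ⊕ toℕ a) (j ⊕ toℕ b)                    ∎
  where
  open ≡-Reasoning
  rows = Vec.tabulate {n = r} λ a′ → Vec.tabulate {n = c} λ b′ → T (i ⊕ toℕ a′) (j ⊕ toℕ b′)

toℕ-⊕ : ∀ {N} (j : Fin N) k .{{_ : NonZero N}} → toℕ (j ⊕ k) ≡ (toℕ j + k) % N
toℕ-⊕ {N} j k = Fin.toℕ-fromℕ< (m%n<n (toℕ j + k) N {{Fin.nonZeroIndex j}})

-- The oriented columns of the torus.

module Construction (n M : ℕ) (n≡ : n ≡ suc (suc M * 2)) (H : HamiltonCycle (states (suc M) (allFin n)))
                    .{{nz : NonZero (length (HamiltonCycle.cycle H))}}
                    (m∣L : suc M ∣ length (HamiltonCycle.cycle H)) where

  m : ℕ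
  m = suc M

  open Periodic H

  s-state : ∀ t → State m (allFin n) (s t)
  s-state t = ∈⇒IsState n m n≡ (s∈ t)

  open Sequence s steps (λ t → State.size (s-state t))

  C : ℕ
  C = 2 ^ M * L

  instance
    2^M≢0 : NonZero (2 ^ M)
    2^M≢0 = m^n≢0 2 M

    C≢0 : NonZero C
    C≢0 = m*n≢0 (2 ^ M) L

  entry-increasing : ∀ t → Increasing (entry t)
  entry-increasing t = subst (Increasing ∘ entry) (+-identityʳ t)
    (All.head (subst (All Increasing) (entries t) (State.increasing (s-state t))))

  -- The residue M = m - 1 carries no digit of the pass number, so that its orientation
  -- in a window reveals the row.
  flagAt : ℕ → ℕ → Bool
  flagAt k p with k <? M
  ... | yes _ = bit k p
  ... | no _ = false

  flagAt-bit : ∀ {k} p → k < M → flagAt k p ≡ bit k p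
  flagAt-bit {k} p k<M with k <? M
  ... | yes _ = refl
  ... | no k≮M = ⊥-elim (k≮M k<M)

  flagAt-M : ∀ p → flagAt M p ≡ false
  flagAt-M p with M <? M
  ... | yes M<M = ⊥-elim (<-irrefl refl M<M)
  ... | no _ = refl

  flagAt-periodic : ∀ k p → flagAt k (p % 2 ^ M) ≡ flagAt k p
  flagAt-periodic k p with k <? M
  ... | yes k<M = trans (sym (bit-periodic M k k<M (p % 2 ^ M) (p / 2 ^ M)))
                        (cong (bit k) (sym (m≡m%n+[m/n]*n p (2 ^ M))))
  ... | no _ = refl

  flag : ℕ → Bool
  flag j = flagAt (j % m) (j / L)

  col : Bool → ℕ → Fin n × Fin n
  col i j = orient (i xor flag j) (entry j)

  -- Both `m` and `L` divide `C`, so reduction modulo `C` keeps the residue and the entry. It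
  -- changes the pass number by a multiple of `2 ^ M`, which the flag does not see.
  col-periodic : ∀ i j → col i (j % C) ≡ col i j
  col-periodic i j = cong₂ (λ f p → orient (i xor f) p)
    (trans (cong₂ flagAt (m∣n⇒o%n%m≡o%m m C j (∣-trans m∣L (n∣m*n (2 ^ M)))) (m%[n*o]/o≡m/o%n j (2 ^ M) L))
           (flagAt-periodic (j % m) (j / L)))
    (entry-cong (s-cong {j % C} {j} (m∣n⇒o%n%m≡o%m L C j (n∣m*n (2 ^ M)))))

  -- A window with top row 1 wraps around to row 0 and so reads every column upside down.
  col-not : ∀ i j → proj₁ (col (not i) j) ≡ proj₂ (col i j)
  col-not false j with flag j
  ... | false = refl
  ... | true = refl
  col-not true j with flag j
  ... | false = refl
  ... | true = refl

  -- Locating the window that spells a given word.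

  module Word (word : Fin m → Fin n × Fin n)
              (unique : Unique (flatten (List.tabulate word))) where

    Spells : Bool → ℕ → Set
    Spells i j = ∀ b → col i (j + toℕ b) ≡ word b

    target : List (Fin n × Fin n)
    target = List.tabulate (norm ∘ word)

    target∈ : target ∈ states m (allFin n)
    target∈ = IsState⇒∈ n m n≡ (subst (State m (allFin n)) (map-tabulate word norm)
      (flatten-State (List.tabulate word) (length-tabulate word) (allFin-unique n m n≡)
        (proj₂ (Unique-⊆-↭ unique (λ {a} _ → ∈-allFin a)))))

    t₀ : ℕ
    t₀ = proj₁ (s-surjective target∈)

    t₀<L : t₀ < L
    t₀<L = proj₁ (proj₂ (s-surjective target∈))

    entry-target : ∀ b → entry (t₀ + toℕ b) ≡ norm (word b)
    entry-target = tabulate-injective (trans (sym (entries t₀)) (proj₂ (proj₂ (s-surjective target∈))))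

    -- Normalising removes the orientations, so the state at `j` is `target`, and each state occurs
    -- once per pass.
    spells⇒t₀ : ∀ {i j} → Spells i j → j % L ≡ t₀
    spells⇒t₀ {i} {j} spells = trans
      (s-injective {j} {t₀} (trans (entries j)
        (trans (List.tabulate-cong entry≡) (sym (proj₂ (proj₂ (s-surjective target∈)))))))
      (m<n⇒m%n≡m t₀<L)
      where
      entry≡ : ∀ b → entry (j + toℕ b) ≡ norm (word b)
      entry≡ b = trans (sym (norm-orient (i xor flag (j + toℕ b)) (entry-increasing (j + toℕ b))))
                       (cong norm (spells b))

    σ : Fin m → Bool
    σ b = proj₁ (orient-norm (word b))

    entry-block : ∀ p b → entry (t₀ + p * L + toℕ b) ≡ norm (word b)
    entry-block p b = trans (entry-cong (s-cong {t₀ + p * L + toℕ b} {t₀ + toℕ b} shifted)) (entry-target b)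
      where
      shifted : (t₀ + p * L + toℕ b) % L ≡ (t₀ + toℕ b) % L
      shifted = trans (cong (_% L) (+-swapʳ t₀ (p * L) (toℕ b))) ([m+kn]%n≡m%n (t₀ + toℕ b) p L)

    -- The number of columns of the window that lie in the following pass.
    θ : ℕ
    θ = (t₀ + m) ∸ L

    residue : Fin m → ℕ
    residue b = (t₀ + toℕ b) % m

    -- Inverse of residue, as t₀ + (k + t₀ * M) = k + t₀ * m.
    slot : ℕ → Fin m
    slot k = (k + t₀ * M) mod m

    residue-slot : ∀ {k} → k < m → residue (slot k) ≡ k
    residue-slot {k} k<m = begin
      (t₀ + toℕ (slot k)) % m      ≡⟨ cong (λ z → (t₀ + z) % m) (Fin.toℕ-fromℕ< (m%n<n (k + t₀ * M) m)) ⟩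
      (t₀ + (k + t₀ * M) % m) % m  ≡⟨ [m+n%d]%d≡[m+n]%d t₀ (k + t₀ * M) m ⟩
      (t₀ + (k + t₀ * M)) % m      ≡⟨ cong (_% m) (multiple t₀ k M) ⟩
      (k + t₀ * m) % m             ≡⟨ [m+kn]%n≡m%n k t₀ m ⟩
      k % m                        ≡⟨ m<n⇒m%n≡m k<m ⟩
      k                            ∎
      where
      open ≡-Reasoning
      multiple : ∀ t k M → t + (k + t * M) ≡ k + t * suc M
      multiple = solve-∀

    slot-residue : ∀ b → slot (residue b) ≡ b
    slot-residue b = Fin.toℕ-injective (begin
      toℕ (slot (residue b))           ≡⟨ Fin.toℕ-fromℕ< (m%n<n (residue b + t₀ * M) m) ⟩
      ((t₀ + toℕ b) % m + t₀ * M) % m  ≡⟨ cong (_% m) (+-comm _ (t₀ * M)) ⟩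
      (t₀ * M + (t₀ + toℕ b) % m) % m  ≡⟨ [m+n%d]%d≡[m+n]%d (t₀ * M) (t₀ + toℕ b) m ⟩
      (t₀ * M + (t₀ + toℕ b)) % m      ≡⟨ cong (_% m) (multiple t₀ (toℕ b) M) ⟩
      (toℕ b + t₀ * m) % m             ≡⟨ [m+kn]%n≡m%n (toℕ b) t₀ m ⟩
      toℕ b % m                        ≡⟨ m<n⇒m%n≡m (Fin.toℕ<n b) ⟩
      toℕ b                            ∎)
      where
      open ≡-Reasoning
      multiple : ∀ t b M → t * M + (t + b) ≡ b + t * suc M
      multiple = solve-∀

    -- Removing `p * L` from the index keeps the residue modulo `m` and lowers the pass by `p`;
    -- `quotient-carry` decides the rest.
    flag-block : ∀ p b → flag (t₀ + p * L + toℕ b) ≡ flagAt (residue b) (p + carry θ (residue b))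
    flag-block p b = trans (cong flag (+-swapʳ t₀ (p * L) (toℕ b))) (cong₂ flagAt
      (%-remove-+ʳ (t₀ + toℕ b) (∣-trans m∣L (n∣m*n p)))
      (begin
        (t₀ + toℕ b + p * L) / L      ≡⟨ +-distrib-/-∣ʳ (t₀ + toℕ b) (n∣m*n p) ⟩
        (t₀ + toℕ b) / L + p * L / L  ≡⟨ cong₂ _+_ (quotient-carry m∣L t₀<L (Fin.toℕ<n b)) (m*n/n≡m p L) ⟩
        carry θ (residue b) + p       ≡⟨ +-comm _ p ⟩
        p + carry θ (residue b)       ∎))
      where open ≡-Reasoning

    spells⁺ : ∀ {i p} → (∀ b → i xor flagAt (residue b) (p + carry θ (residue b)) ≡ σ b) → Spells i (t₀ + p * L)
    spells⁺ {i} {p} h b = begin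
      orient (i xor flag j) (entry j)     ≡⟨ cong₂ (λ f q → orient (i xor f) q) (flag-block p b) (entry-block p b) ⟩
      orient (i xor flagAt (residue b) (p + carry θ (residue b))) (norm (word b))
                                          ≡⟨ cong (λ τ → orient τ (norm (word b))) (h b) ⟩
      orient (σ b) (norm (word b))        ≡⟨ proj₂ (orient-norm (word b)) ⟩
      word b                              ∎
      where
      open ≡-Reasoning
      j = t₀ + p * L + toℕ b

    spells⁻ : ∀ {i p} → Spells i (t₀ + p * L) → ∀ b → i xor flagAt (residue b) (p + carry θ (residue b)) ≡ σ b
    spells⁻ {i} {p} spells b = orient-injective
      (subst Increasing (entry-block p b) (entry-increasing j))
      (begin
        orient (i xor flagAt (residue b) (p + carry θ (residue b))) (norm (word b))
          ≡⟨ cong₂ (λ f q → orient (i xor f) q) (flag-block p b) (entry-block p b) ⟨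
        orient (i xor flag j) (entry j)   ≡⟨ spells b ⟩
        word b                            ≡⟨ proj₂ (orient-norm (word b)) ⟨
        orient (σ b) (norm (word b))      ∎)
      where
      open ≡-Reasoning
      j = t₀ + p * L + toℕ b

    -- The flag at residue `M` is always `false`, so the orientation found there is the row.
    i₀ : Bool
    i₀ = σ (slot M)

    -- The effect of the row is cancelled, which leaves the flags that the pass number has to
    -- provide.
    required : ℕ → Bool
    required k = i₀ xor σ (slot k)

    p₀ : ℕ
    p₀ = proj₁ (counts-exists M θ required)

    p₀-counts : Counts M θ required p₀
    p₀-counts = proj₂ (counts-exists M θ required)

    j₀ : ℕ
    j₀ = t₀ + p₀ * L

    j₀<C : j₀ < C
    j₀<C = begin-strict
      t₀ + p₀ * L   <⟨ +-monoˡ-< (p₀ * L) t₀<L ⟩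
      suc p₀ * L    ≤⟨ *-monoˡ-≤ L (bounded p₀-counts) ⟩
      2 ^ M * L     ∎
      where open ≤-Reasoning

    spells₀ : Spells i₀ j₀
    spells₀ = spells⁺ {i₀} {p₀} λ b →
      trans (by-residue (residue b) (m%n<n (t₀ + toℕ b) m)) (cong σ (slot-residue b))
      where
      by-residue : ∀ k → k < m → i₀ xor flagAt k (p₀ + carry θ k) ≡ σ (slot k)
      by-residue k k<m = [ (λ k<M → trans (cong (i₀ xor_) (trans (flagAt-bit _ k<M) (bits p₀-counts k<M)))
                                          (xor-cancelˡ i₀ (σ (slot k))))
                         , (λ { refl → trans (cong (i₀ xor_) (flagAt-M _)) (xor-identityʳ i₀) })
                         ]′ (m≤n⇒m<n∨m≡n (≤-pred k<m))

    -- The state fixes `j` modulo `L`, residue `M` fixes the row, and the other residues fix all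
    -- digits of the pass through `Counts`.
    spells-unique : ∀ {i j} → j < C → Spells i j → i₀ ≡ i × j₀ ≡ j
    spells-unique {i} {j} j<C spells = i₀≡i , trans (cong (λ q → t₀ + q * L) p₀≡p) (sym j≡)
      where
      p = j / L

      j≡ : j ≡ t₀ + p * L
      j≡ = trans (m≡m%n+[m/n]*n j L) (cong (_+ p * L) (spells⇒t₀ {i} {j} spells))

      orientations : ∀ {k} → k < m → i xor flagAt k (p + carry θ k) ≡ σ (slot k)
      orientations {k} k<m = subst (λ r → i xor flagAt r (p + carry θ r) ≡ σ (slot k)) (residue-slot k<m)
        (spells⁻ {i} {p} (subst (Spells i) j≡ spells) (slot k))

      i₀≡i : i₀ ≡ i
      i₀≡i = trans (sym (orientations ≤-refl))
        (trans (cong (i xor_) (flagAt-M (p + carry θ M))) (xor-identityʳ i))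

      p₀≡p : p₀ ≡ p
      p₀≡p = counts-unique M p₀-counts (counts (m<n*o⇒m/o<n j<C) λ {k} k<M → begin
        bit k (p + carry θ k)                       ≡⟨ flagAt-bit _ k<M ⟨
        flagAt k (p + carry θ k)                    ≡⟨ xor-cancelˡ i _ ⟨
        i xor (i xor flagAt k (p + carry θ k))      ≡⟨ cong₂ _xor_ (sym i₀≡i) (orientations (m<n⇒m<1+n k<M)) ⟩
        required k                                  ∎)
        where open ≡-Reasoning

  -- The torus and its windows.

  row : Fin 2 → Bool
  row Fin.zero = false
  row (Fin.suc _) = true

  torus : Torus 2 C n
  torus i j = proj₁ (col (row i) (toℕ j))

  row-⊕0 : ∀ i → row (i ⊕ 0) ≡ row i
  row-⊕0 0F = refl
  row-⊕0 1F = refl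

  row-⊕1 : ∀ i → row (i ⊕ 1) ≡ not (row i)
  row-⊕1 0F = refl
  row-⊕1 1F = refl

  torus-⊕ : ∀ i j a k → torus (i ⊕ a) (j ⊕ k) ≡ proj₁ (col (row (i ⊕ a)) (toℕ j + k))
  torus-⊕ i j a k = cong proj₁ {x = col i′ (toℕ (j ⊕ k))} {y = col i′ (toℕ j + k)}
    (trans (cong (col i′) (toℕ-⊕ {C} j k)) (col-periodic i′ (toℕ j + k)))
    where i′ = row (i ⊕ a)

  torus-top : ∀ i j k → torus (i ⊕ 0) (j ⊕ k) ≡ proj₁ (col (row i) (toℕ j + k))
  torus-top i j k = trans (torus-⊕ i j 0 k) (cong (λ i → proj₁ (col i (toℕ j + k))) (row-⊕0 i))

  torus-bottom : ∀ i j k → torus (i ⊕ 1) (j ⊕ k) ≡ proj₂ (col (row i) (toℕ j + k))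
  torus-bottom i j k =
    trans (torus-⊕ i j 1 k)
      (trans (cong (λ i → proj₁ (col i (toℕ j + k))) (row-⊕1 i)) (col-not (row i) (toℕ j + k)))

  module _ (w : Vec (Fin n) (2 * m)) where

    word : Fin m → Fin n × Fin n
    word b = Vec.lookup w (combine {2} 0F b) , Vec.lookup w (combine {2} 1F b)

    Spells′ : Fin 2 × Fin C → Set
    Spells′ (i , j) = ∀ b → col (row i) (toℕ j + toℕ b) ≡ word b

    spells⇒window : ∀ p → Spells′ p → window 2 m torus p ≡ w
    spells⇒window p@(i , j) h = combine-ext 2 λ
      { 0F b → trans (lookup-window 2 m torus p 0F b) (trans (torus-top i j (toℕ b)) (cong proj₁ (h b)))
      ; 1F b → trans (lookup-window 2 m torus p 1F b) (trans (torus-bottom i j (toℕ b)) (cong proj₂ (h b))) }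

    window⇒spells : ∀ p → window 2 m torus p ≡ w → Spells′ p
    window⇒spells p@(i , j) eq b = cong₂ _,_
      (trans (sym (torus-top i j (toℕ b))) (trans (sym (lookup-window 2 m torus p 0F b)) (at 0F)))
      (trans (sym (torus-bottom i j (toℕ b))) (trans (sym (lookup-window 2 m torus p 1F b)) (at 1F)))
      where
      at : ∀ a → Vec.lookup (window 2 m torus p) (combine {2} a b) ≡ Vec.lookup w (combine {2} a b)
      at a = cong (λ v → Vec.lookup v (combine {2} a b)) eq

    module _ (unique : VecUnique.Unique w) where

      injective : ∀ {a c : Fin 2} {b d : Fin m} → Vec.lookup w (combine {2} a b) ≡ Vec.lookup w (combine {2} c d) → a ≡ c × b ≡ d
      injective {a} {c} {b} {d} eq = Fin.combine-injective a b c d (VecUnique.lookup-injective unique _ _ eq)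

      word-unique : Unique (flatten (List.tabulate word))
      word-unique = Unique-resp-↭ (↭-sym (flatten-↭ (List.tabulate word)))
        (subst Unique
          (sym (cong₂ _++_ (map-tabulate word proj₁) (map-tabulate word proj₂)))
          (Unique.++⁺ (Unique.tabulate⁺ {f = proj₁ ∘ word} (λ eq → proj₂ (injective {0F} {0F} eq)))
                      (Unique.tabulate⁺ {f = proj₂ ∘ word} (λ eq → proj₂ (injective {1F} {1F} eq)))
                      disjoint))
        where
        disjoint : ∀ {v} → ¬ (v ∈ List.tabulate (proj₁ ∘ word) × v ∈ List.tabulate (proj₂ ∘ word))
        disjoint (h₁ , h₂) with ∈-tabulate⁻ h₁ | ∈-tabulate⁻ h₂
        ... | b , eq₁ | c , eq₂ with proj₁ (injective {0F} {1F} {b} {c} (trans (sym eq₁) eq₂))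
        ... | ()

      open Word word word-unique

      fromBool : Bool → Fin 2
      fromBool false = 0F
      fromBool true = 1F

      row-fromBool : ∀ i → row (fromBool i) ≡ i
      row-fromBool false = refl
      row-fromBool true = refl

      fromBool-row : ∀ i → fromBool (row i) ≡ i
      fromBool-row 0F = refl
      fromBool-row 1F = refl

      window-exists : ∃! _≡_ λ p → window 2 m torus p ≡ w
      window-exists = p , spells⇒window p spelled , λ {q} → uniq q
        where
        p : Fin 2 × Fin C
        p = fromBool i₀ , fromℕ< j₀<C

        spelled : Spells′ p
        spelled b = trans
          (cong₂ (λ i j → col i (j + toℕ b)) (row-fromBool i₀) (Fin.toℕ-fromℕ< j₀<C))
          (spells₀ b)

        uniq : ∀ q → window 2 m torus q ≡ w → p ≡ q
        uniq q@(i , j) eq = cong₂ _,_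
          (trans (cong fromBool (proj₁ same)) (fromBool-row i))
          (Fin.toℕ-injective (trans (Fin.toℕ-fromℕ< j₀<C) (proj₂ same)))
          where same = spells-unique {row i} {toℕ j} (Fin.toℕ<n j) (window⇒spells q eq)

  -- The length `N` is a variable so that matching on `size` makes the cast an identity.
  universal-torus : ∀ {N} (size : 2 * m ≡ N) (w : Vec (Fin n) N) → VecUnique.Unique w →
                    ∃! _≡_ λ p → Vec.cast size (window 2 m torus p) ≡ w
  universal-torus refl w u = let p , eq , uniq = window-exists w u in
    p , trans (Vec.cast-is-id refl _) eq , λ {q} eq′ → uniq (trans (sym (Vec.cast-is-id refl _)) eq′)

  -- Matching blocks.

  pair-↭ : ∀ σ (p : Fin n × Fin n) → let q = orient σ p in
           proj₁ q ∷ proj₂ q ∷ [] ↭ proj₁ p ∷ proj₂ p ∷ []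
  pair-↭ false p = refl
  pair-↭ true (a , b) = swap b a refl

  column-↭ : ∀ j → column torus j ↭ proj₁ (entry (toℕ j)) ∷ proj₂ (entry (toℕ j)) ∷ []
  column-↭ j rewrite col-not false (toℕ j) = pair-↭ (flag (toℕ j)) (entry (toℕ j))

  -- Columns in the same place of two passes carry the same entry and differ at most in orientation.
  columns-match : ∀ j k → toℕ j % L ≡ toℕ k % L → ColumnsMatch torus j k
  columns-match j k eq = bag-=⇒ (↭⇒∼bag (↭-trans (column-↭ j)
    (subst (λ q → proj₁ q ∷ proj₂ q ∷ [] ↭ column torus k)
      (entry-cong (s-cong {toℕ k} {toℕ j} (sym eq))) (↭-sym (column-↭ k)))))

  origin : Fin C
  origin = fromℕ< (>-nonZero⁻¹ C)

  block-residue : ∀ p t → toℕ (origin ⊕ (p * L) ⊕ t) % L ≡ t % L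
  block-residue p t = begin
    toℕ (origin ⊕ (p * L) ⊕ t) % L      ≡⟨ cong (_% L) (toℕ-⊕ {C} (origin ⊕ (p * L)) t) ⟩
    (toℕ (origin ⊕ (p * L)) + t) % C % L  ≡⟨ m∣n⇒o%n%m≡o%m L C _ L∣C ⟩
    (toℕ (origin ⊕ (p * L)) + t) % L    ≡⟨ cong (λ z → (z + t) % L) (toℕ-⊕ {C} origin (p * L)) ⟩
    ((toℕ origin + p * L) % C + t) % L  ≡⟨ cong (λ z → ((z + p * L) % C + t) % L) (Fin.toℕ-fromℕ< (>-nonZero⁻¹ C)) ⟩
    (p * L % C + t) % L                 ≡⟨ cong (_% L) (+-comm _ t) ⟩
    (t + p * L % C) % L                 ≡⟨ %-remove-+ʳ t (%-presˡ-∣ (n∣m*n p) L∣C) ⟩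
    t % L                               ∎
    where
    open ≡-Reasoning
    L∣C : L ∣ C
    L∣C = n∣m*n (2 ^ M)

  partitions : PartitionsIntoMatchingBlocks (2 ^ M) L torus
  partitions = refl , origin , λ p q t →
    columns-match _ _ (trans (block-residue (toℕ p) (toℕ t)) (sym (block-residue (toℕ q) (toℕ t))))

-- Sizes and assembly.

TorusWithBlocks : (n m C ℓ : ℕ) → Set
TorusWithBlocks n m C ℓ =
  Σ[ T ∈ Torus 2 C n ] (IsShorthandUniversalTorus 2 m T × PartitionsIntoMatchingBlocks (2 ^ (m ∸ 1)) ℓ T)

build : ∀ n M → n ≡ suc (suc M * 2) → TorusWithBlocks n (suc M) (n ! / 2) (n ! /2^ suc M)
-- The construction has width `2 ^ M * L` and blocks of length `L`; both are transported to the
-- quotients of `n !`.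
build n M n≡ = subst₂ (TorusWithBlocks n m) C≡ L≡
  (torus , record { torus-size = sym size ; window-size = window-size ; universal = universal-torus window-size } , partitions)
  where
  m = suc M

  H : HamiltonCycle (states m (allFin n))
  H = hamilton {n} {M} n≡

  open HamiltonCycle H

  L : ℕ
  L = length cycle

  -- The cycle and the enumeration are duplicate-free and contain each other, so their lengths
  -- agree.
  L≡stateCount : L ≡ stateCount m
  L≡stateCount = trans
    (≤-antisym (Unique-⊆-length distinct sound)
               (Unique-⊆-length (states-unique m (allFin-unique n m n≡)) complete))
    (length-states m (allFin n) (trans (length-tabulate id) n≡))

  instance
    L≢0 : NonZero L
    L≢0 = subst NonZero (sym L≡stateCount) (stateCount-nonZero m)

  m∣L : m ∣ L
  m∣L = subst (m ∣_) (sym L≡stateCount) (∣-trans (n∣m*n (suc (m * 2))) (m∣m*n (stateCount M)))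

  open Construction n M n≡ H m∣L using (torus; universal-torus; partitions)

  n!≡ : n ! ≡ L * 2 ^ m
  n!≡ = trans (cong _! n≡) (trans (sym (stateCount-! m)) (cong (_* 2 ^ m) (sym L≡stateCount)))

  size : n ! ≡ 2 * (2 ^ M * L)
  size = trans n!≡ (trans (*-comm L (2 ^ m)) (*-assoc 2 (2 ^ M) L))

  C≡ : 2 ^ M * L ≡ n ! / 2
  C≡ = sym (trans (cong (_/ 2) (trans size (*-comm 2 (2 ^ M * L)))) (m*n/n≡m (2 ^ M * L) 2))

  L≡ : L ≡ n ! /2^ m
  L≡ = sym (trans (cong (_/2^ m) n!≡) (m*n/n≡m L (2 ^ m) {{m^n≢0 2 m}}))

  window-size : 2 * m ≡ n ∸ 1
  window-size = trans (*-comm 2 m) (sym (cong (_∸ 1) n≡))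

theorem1 : (n m : ℕ) → n ≡ 2 * m + 1 → 3 ≤ n →
    Σ[ T ∈ Torus 2 (n ! / 2) n ]
    (IsShorthandUniversalTorus 2 m T ×
    PartitionsIntoMatchingBlocks (2 ^ (m ∸ 1)) (n ! /2^ m) T)
theorem1 n (suc M) n≡ _ = build n M (trans n≡ (trans (+-comm (2 * suc M) 1) (cong suc (*-comm 2 (suc M)))))
theorem1 n zero refl (s≤s ())
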